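{- Let $n>1$ be an odd integer. A $(K_2,K_{1,n})$-$URD(v;1,s)$ exists if and only if $v \equiv 2(n+1) \pmod{n(n+1)}$.
   Context: For graphs $H_1,H_2$, an $(H_1,H_2)$-$URD(v;r,s)$ is a decomposition of the edge set of the complete graph $K_v$ into edge-disjoint subgraphs (blocks), where the blocks are partitioned into $r+s$ classes, each class being a spanning collection of vertex-disjoint blocks (every vertex of $K_v$ lies in exactly one block of the class), such that $r$ classes consist only of copies of $H_1$ and $s$ classes consist only of copies of $H_2$. Here $K_2$ is a single edge (so a class of copies of $K_2$ is a 1-factor, i.e. a perfect matching) and $K_{1,n}$ is the star with $n$ edges ($n$-star). -}

module Defs where

open import Data.Nat.Base using (ℕ; suc; ∣_-_∣)
open import Data.Nat.Divisibility using (_∣_)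
open import Data.Fin.Base using (Fin; zero)
open import Data.Product using (Σ-syntax; ∃!; ∃-syntax; _×_; _,_)
open import Data.Sum.Base as Sum using (_⊎_; inj₁; inj₂; [_,_]′)
open import Function.Definitions using (Injective)
open import Relation.Binary.Core using (Rel)
open import Relation.Binary.Definitions using (Symmetric; Irreflexive)
open import Relation.Binary.PropositionalEquality using (_≡_; _≢_; refl; ≢-sym)
open import Level using (0ℓ)

record Graph : Set₁ where
  field
    order      : ℕ
    Adj        : Rel (Fin order) 0ℓ
    adj-sym    : Symmetric Adj
    adj-irrefl : Irreflexive _≡_ Adj

  Vertex : Set
  Vertex = Fin order

open Graph public

K : ℕ → Graph
K n = record
  { order      = n
  ; Adj        = _≢_
  ; adj-sym    = ≢-sym
  ; adj-irrefl = λ x≡y x≢y → x≢y x≡y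
  }

-- K_{1,n}, with centre zero.
Star : ℕ → Graph
Star n = record
  { order      = suc n
  ; Adj        = λ x y → (x ≡ zero × y ≢ zero) ⊎ (y ≡ zero × x ≢ zero)
  ; adj-sym    = Sum.swap
  ; adj-irrefl = λ { refl (inj₁ (p , q)) → q p ; refl (inj₂ (p , q)) → q p }
  }

-- A copy of H in G: the (not necessarily induced) subgraph of G which is the
-- image of H under an injective homomorphism.
record Copy (H G : Graph) : Set where
  field
    embed     : Vertex H → Vertex G
    injective : Injective _≡_ _≡_ embed
    preserves : ∀ {a b} → Adj H a b → Adj G (embed a) (embed b)

open Copy public

HasVertex : ∀ {H G} → Copy H G → Vertex G → Set
HasVertex {H} B x = ∃[ a ] embed B a ≡ x

HasEdge : ∀ {H G} → Copy H G → Vertex G → Vertex G → Set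
HasEdge {H} B x y = ∃[ a ] ∃[ b ] Adj H a b × embed B a ≡ x × embed B b ≡ y

record ParallelClass (H G : Graph) : Set where
  field
    size     : ℕ
    block    : Fin size → Copy H G
    spanning : ∀ x → ∃! _≡_ λ i → HasVertex (block i) x

open ParallelClass public

-- An (H₁,H₂)-URD(v;r,s).
record URD (H₁ H₂ : Graph) (v r s : ℕ) : Set where
  field
    class₁ : Fin r → ParallelClass H₁ (K v)
    class₂ : Fin s → ParallelClass H₂ (K v)

  BlockIndex : Set
  BlockIndex = (Σ[ c ∈ Fin r ] Fin (size (class₁ c)))
             ⊎ (Σ[ c ∈ Fin s ] Fin (size (class₂ c)))

  EdgeOfBlock : Vertex (K v) → Vertex (K v) → BlockIndex → Set
  EdgeOfBlock x y = [ (λ (c , i) → HasEdge (block (class₁ c) i) x y)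
                    , (λ (c , i) → HasEdge (block (class₂ c) i) x y) ]′

  field
    decomposes : ∀ {x y} → Adj (K v) x y → ∃! _≡_ (EdgeOfBlock x y)

infix 4 _≡_[mod_]

_≡_[mod_] : ℕ → ℕ → ℕ → Set
a ≡ b [mod m ] = m ∣ ∣ a - b ∣

module Submission where

-- Necessity.  Every class of stars has a = v/(n+1) stars, so counting ordered pairs of vertices gives
-- v² = 2v + 2 s a n; cancelling a leaves (n+1) v = 2(n+1) + 2 s n, whence n ∣ a - 2.
--
-- Sufficiency.  Since all the sizes are right, it is enough that every class covers every vertex and that every
-- edge is covered: surjections between sets of equal size are injective.  Let v = (n+1) a with a = 2 + q n and
-- take as vertices n+1 rows, each a copy of ℤ/a.  One spanning class of a stars (the base class) is translated
-- by ℤ/a.  It realises every difference inside a row (except a/2, which is left to the matching if a is even),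
-- and few differences between different rows.  For any choice of offsets the translates of a star with one leaf
-- in each other row form a spanning class, so such classes can be chosen freely to realise all the differences
-- between rows that are still missing; only their number matters.
-- In the base class (absent if q = 0) every row contains ⌊q/2⌋ stars, packed in a zigzag pattern, and, when q is
-- odd, also the centre and half of the leaves of a star whose other leaves reach other rows along a regular
-- tournament on the rows with a perfect matching removed.  All remaining vertices of the base class lie in stars
-- centred in row 0 with a leaf in each other row.

open import Data.Empty using (⊥-elim)
open import Data.Fin as Fin using (Fin; zero; suc; toℕ; fromℕ<; cast; combine; remQuot; punchIn; punchOut; _↑ˡ_; _↑ʳ_; splitAt; opposite)
open import Data.Fin.Permutation using (↔⇒≡)
import Data.Fin.Properties as Finₚ
open import Data.Nat
open import Data.Nat.Divisibility
open import Data.Nat.DivMod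
open import Data.Nat.Properties
open import Data.Nat.Tactic.RingSolver using (solve-∀)
open import Data.Product
open import Data.Product.Function.NonDependent.Propositional using (_×-↔_)
open import Data.Sum
open import Data.Sum.Function.Propositional using (_⊎-↔_)
open import Function using (_∘_; case_of_)
open import Function.Bundles using (_⇔_; _↔_; mk⇔; mk⤖; mk↔ₛ′)
open import Function.Construct.Composition using (_↔-∘_)
open import Function.Construct.Identity using (↔-id)
open import Function.Construct.Symmetry using (↔-sym)
open import Function.Definitions using (Injective)
open import Function.Properties.Bijection using (⤖⇒↔)
open import Relation.Binary.Definitions using (tri<; tri≈; tri>)
open import Relation.Binary.PropositionalEquality
open import Relation.Nullary
open import Defs

-- Counting in finite sets

injective⇒surjective : ∀ {N} (f : Fin N → Fin N) → Injective _≡_ _≡_ f → ∀ y → ∃ λ x → f x ≡ y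
injective⇒surjective {zero} f inj ()
injective⇒surjective {suc N} f inj y with Finₚ.any? (λ x → f x Finₚ.≟ y)
... | yes p = p
-- Pigeonhole: punching out the missed value `y` would inject `Fin (suc N)` into `Fin N`.
... | no ¬p = ⊥-elim (1+n≰n (Finₚ.injective⇒≤ {f = λ x → punchOut (miss x)}
                (λ {i} {j} e → inj (Finₚ.punchOut-injective (miss i) (miss j) e))))
  where
  miss : ∀ x → y ≢ f x
  miss x e = ¬p (x , sym e)

-- A section of `f` is injective, hence onto, so every point is a chosen preimage and is recovered
-- from its value under `f`.
surjective⇒injective : ∀ {N} (f : Fin N → Fin N) → (∀ y → ∃ λ x → f x ≡ y) → Injective _≡_ _≡_ f
surjective⇒injective f sur {x} {y} fx≡fy =
  let (i , gi≡x) = injective⇒surjective g g-inj x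
      (j , gj≡y) = injective⇒surjective g g-inj y
      i≡j = begin
        i        ≡⟨ proj₂ (sur i) ⟨
        f (g i)  ≡⟨ cong f gi≡x ⟩
        f x      ≡⟨ fx≡fy ⟩
        f y      ≡⟨ cong f gj≡y ⟨
        f (g j)  ≡⟨ proj₂ (sur j) ⟩
        j        ∎
  in trans (sym gi≡x) (trans (cong g i≡j) gj≡y)
  where
  open ≡-Reasoning
  g = proj₁ ∘ sur
  g-inj : Injective _≡_ _≡_ g
  g-inj {i} {j} e = trans (sym (proj₂ (sur i))) (trans (cong f e) (proj₂ (sur j)))

-- The value `g zero` is punched out and the rest is handled recursively. Later `g` lists the
-- differences already realised between two rows, and `e` the missing ones.
complement : ∀ {β N a} (g : Fin β → Fin a) → Injective _≡_ _≡_ g → β + N ≡ a →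
  Σ (Fin N → Fin a) λ e → ∀ x → (∃ λ i → g i ≡ x) ⊎ (∃ λ j → e j ≡ x)
complement {zero} g inj refl = (λ j → j) , λ x → inj₂ (x , refl)
complement {suc β} {N} {suc a} g inj eq = e′ , cov
  where
  ≢g : ∀ i → g zero ≢ g (suc i)
  ≢g i p = case inj p of λ ()
  rec = complement {β} {N} {a} (λ i → punchOut (≢g i))
          (λ {i} {j} p → Finₚ.suc-injective (inj (Finₚ.punchOut-injective (≢g i) (≢g j) p)))
          (suc-injective eq)
  e′ : Fin N → Fin (suc a)
  e′ = punchIn (g zero) ∘ proj₁ rec
  cov : ∀ x → (∃ λ i → g i ≡ x) ⊎ (∃ λ j → e′ j ≡ x)
  cov x with g zero Finₚ.≟ x
  ... | yes p = inj₁ (zero , p)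
  ... | no ≢x with proj₂ rec (punchOut ≢x)
  ...   | inj₁ (i , p) = inj₁ (suc i , Finₚ.punchOut-injective (≢g i) ≢x p)
  ...   | inj₂ (j , p) = inj₂ (j , trans (cong (punchIn (g zero)) p) (Finₚ.punchIn-punchOut ≢x))

-- A listing need only be exhaustive: repetitions are ruled out later by comparing its length with
-- the size of the target of a map.
record Listing (A : Set) (N : ℕ) : Set where
  field
    at  : Fin N → A
    hit : ∀ x → ∃ λ i → at i ≡ x

open Listing public

Fin-listing : ∀ N → Listing (Fin N) N
Fin-listing N = record { at = λ i → i ; hit = λ x → x , refl }

image-listing : ∀ {A B N} (f : A → B) → (∀ y → ∃ λ x → f x ≡ y) → Listing A N → Listing B N
image-listing f sur L = record
  { at  = f ∘ at L
  ; hit = λ y → let (x , p) = sur y ; (i , q) = hit L x in i , trans (cong f q) p }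

_⊎-listing_ : ∀ {A B M N} → Listing A M → Listing B N → Listing (A ⊎ B) (M + N)
_⊎-listing_ {A} {B} {M} {N} K L = record { at = at′ ; hit = hit′ }
  where
  at′ : Fin (M + N) → A ⊎ B
  at′ = Data.Sum.map (at K) (at L) ∘ splitAt M
  hit′ : ∀ x → ∃ λ i → at′ i ≡ x
  hit′ (inj₁ x) = let (i , p) = hit K x in i ↑ˡ N ,
    trans (cong (Data.Sum.map (at K) (at L)) (Finₚ.splitAt-↑ˡ M i N)) (cong inj₁ p)
  hit′ (inj₂ y) = let (i , p) = hit L y in M ↑ʳ i ,
    trans (cong (Data.Sum.map (at K) (at L)) (Finₚ.splitAt-↑ʳ M N i)) (cong inj₂ p)

_×-listing_ : ∀ {A B M N} → Listing A M → Listing B N → Listing (A × B) (M * N)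
_×-listing_ {A} {B} {M} {N} K L = record { at = at′ ; hit = hit′ }
  where
  at′ : Fin (M * N) → A × B
  at′ i = let (j , k) = remQuot {M} N i in at K j , at L k
  hit′ : ∀ x → ∃ λ i → at′ i ≡ x
  hit′ (x , y) = let (i , p) = hit K x ; (j , q) = hit L y in combine i j ,
    trans (cong (λ (j , k) → at K j , at L k) (Finₚ.remQuot-combine i j)) (cong₂ _,_ p q)

listed⇒injective : ∀ {A N} (f : A → Fin N) → Listing A N → (∀ y → ∃ λ x → f x ≡ y) → Injective _≡_ _≡_ f
listed⇒injective f L sur {x} {y} e =
  let (i , p) = hit L x
      (j , q) = hit L y
      i≡j = surjective⇒injective (f ∘ at L) (hit (image-listing f sur L))
              (trans (cong f p) (trans e (sym (cong f q))))
  in trans (sym p) (trans (cong (at L) i≡j) q)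

listed-pairs⇒injective : ∀ {A v} (f : A → Fin v × Fin v) → Listing A (v * v) →
  (∀ y → ∃ λ x → f x ≡ y) → Injective _≡_ _≡_ f
listed-pairs⇒injective {A} {v} f L sur e =
  listed⇒injective (λ x → combine (proj₁ (f x)) (proj₂ (f x))) L sur′
    (cong (λ (x , y) → combine x y) e)
  where
  sur′ : ∀ y → ∃ λ x → combine (proj₁ (f x)) (proj₂ (f x)) ≡ y
  sur′ y = let (j , k , p) = Finₚ.combine-surjective {v} {v} y
               (x , q) = sur (j , k)
           in x , trans (cong (λ (x , y) → combine x y) q) p

-- Darts

Dart : ℕ → Set
Dart n = Fin n × Fin 2

-- The bit of a dart is its direction: `zero` leads from the centre to a leaf, `suc zero` back.
-- Directed edges match ordered pairs of vertices.
tail head : ∀ {n} → Dart n → Fin (suc n)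
tail (i , zero)     = zero
tail (i , suc zero) = suc i
head (i , zero)     = suc i
head (i , suc zero) = zero

star-adjacent : ∀ {n} (d : Dart n) → Adj (Star n) (tail d) (head d)
star-adjacent (i , zero)     = inj₁ (refl , λ ())
star-adjacent (i , suc zero) = inj₂ (refl , λ ())

star-dart : ∀ {n a b} → Adj (Star n) a b → ∃ λ (d : Dart n) → tail d ≡ a × head d ≡ b
star-dart {b = zero}  (inj₁ (refl , b≢0)) = ⊥-elim (b≢0 refl)
star-dart {b = suc b} (inj₁ (refl , b≢0)) = (b , zero) , refl , refl
star-dart {a = zero}  (inj₂ (refl , a≢0)) = ⊥-elim (a≢0 refl)
star-dart {a = suc a} (inj₂ (refl , a≢0)) = (a , suc zero) , refl , refl

flip₂ : Fin 2 → Fin 2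
flip₂ zero       = suc zero
flip₂ (suc zero) = zero

≢-flip₂ : ∀ b → b ≢ flip₂ b
≢-flip₂ zero ()
≢-flip₂ (suc zero) ()

≢⇒flip₂ : ∀ {a b : Fin 2} → a ≢ b → flip₂ a ≡ b
≢⇒flip₂ {zero}     {zero}     a≢b = ⊥-elim (a≢b refl)
≢⇒flip₂ {zero}     {suc zero} a≢b = refl
≢⇒flip₂ {suc zero} {zero}     a≢b = refl
≢⇒flip₂ {suc zero} {suc zero} a≢b = ⊥-elim (a≢b refl)

-- Coverings of the right size are decompositions

data CoveredEdge {v w s a n} (M : Fin w → Fin 2 → Fin v) (S : Fin s → Fin a → Fin (suc n) → Fin v)
                 (x y : Fin v) : Set where
  inMatching : ∀ i b → M i b ≡ x → M i (flip₂ b) ≡ y → CoveredEdge M S x y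
  inStar     : ∀ c i (d : Dart n) → S c i (tail d) ≡ x → S c i (head d) ≡ y → CoveredEdge M S x y

-- The blocks offer exactly `v` places for `v` vertices, so a covering uses each vertex once. This
-- gives both the injectivity of every block and the disjointness of the blocks.
coveringClass : ∀ {H v a} (f : Fin a → Vertex H → Fin v) → a * order H ≡ v →
  (∀ x → ∃ λ i → ∃ λ b → f i b ≡ x) → ParallelClass H (K v)
coveringClass {H} {v} {a} f size·order cov = record
  { size = a
  ; block = λ i → record
      { embed     = f i
      ; injective = λ e → cong proj₂ (inj e)
      ; preserves = λ adj e → adj-irrefl H (cong proj₂ (inj e)) adj }
  ; spanning = λ x → let (i , b , p) = cov x in
      i , (b , p) , λ (b′ , p′) → cong proj₁ (inj (trans p (sym p′))) }
  where
  inj : ∀ {i b i′ b′} → f i b ≡ f i′ b′ → (i , b) ≡ (i′ , b′)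
  inj = listed⇒injective (λ (i , b) → f i b)
          (subst (Listing _) size·order (Fin-listing a ×-listing Fin-listing (order H)))
          (λ x → let (i , b , p) = cov x in (i , b) , p)

-- The third equation says that diagonal pairs, matching darts and star darts together are as many
-- as the ordered pairs of vertices. Since they cover all pairs, each pair arises only once.
coveringURD : ∀ {v w s a n} (M : Fin w → Fin 2 → Fin v) (S : Fin s → Fin a → Fin (suc n) → Fin v) →
  w * 2 ≡ v → a * suc n ≡ v → v + (w * 2 + (s * a) * (n * 2)) ≡ v * v →
  (∀ x → ∃ λ i → ∃ λ b → M i b ≡ x) →
  (∀ c x → ∃ λ i → ∃ λ b → S c i b ≡ x) →
  (∀ x y → x ≢ y → CoveredEdge M S x y) →
  URD (K 2) (Star n) v 1 s
coveringURD {v} {w} {s} {a} {n} M S w2 an count covM covS covE = record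
  { class₁ = C₁ ; class₂ = C₂ ; decomposes = dec }
  where
  C₁ : Fin 1 → ParallelClass (K 2) (K v)
  C₁ _ = coveringClass M w2 covM
  C₂ : Fin s → ParallelClass (Star n) (K v)
  C₂ c = coveringClass (S c) an (covS c)

  Darts : Set
  Darts = Fin v ⊎ (Fin w × Fin 2) ⊎ ((Fin s × Fin a) × Dart n)

  ends : Darts → Fin v × Fin v
  ends (inj₁ x) = x , x
  ends (inj₂ (inj₁ (i , b))) = M i b , M i (flip₂ b)
  ends (inj₂ (inj₂ ((c , i) , d))) = S c i (tail d) , S c i (head d)

  darts : Listing Darts (v * v)
  darts = subst (Listing Darts) count
    (Fin-listing v ⊎-listing ((Fin-listing w ×-listing Fin-listing 2) ⊎-listing
      ((Fin-listing s ×-listing Fin-listing a) ×-listing (Fin-listing n ×-listing Fin-listing 2))))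

  ends-onto : ∀ p → ∃ λ d → ends d ≡ p
  ends-onto (x , y) with x Finₚ.≟ y
  ... | yes refl = inj₁ x , refl
  ... | no x≢y with covE x y x≢y
  ...   | inMatching i b p q = inj₂ (inj₁ (i , b)) , cong₂ _,_ p q
  ...   | inStar c i d p q   = inj₂ (inj₂ ((c , i) , d)) , cong₂ _,_ p q

  ends-injective : Injective _≡_ _≡_ ends
  ends-injective = listed-pairs⇒injective ends darts ends-onto

  Block : Set
  Block = (Σ (Fin 1) λ _ → Fin w) ⊎ (Σ (Fin s) λ _ → Fin a)

  Edge : Fin v → Fin v → Block → Set
  Edge x y = [ (λ (c , i) → HasEdge (block (C₁ c) i) x y) , (λ (c , i) → HasEdge (block (C₂ c) i) x y) ]′

  -- The second argument is the value for the diagonal pairs, which lie in no block.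
  blockOf : Darts → Block → Block
  blockOf (inj₁ _) β = β
  blockOf (inj₂ (inj₁ (i , _))) _ = inj₁ (zero , i)
  blockOf (inj₂ (inj₂ (ci , _))) _ = inj₂ ci

  dartOf : ∀ {x y} β → Edge x y β → ∃ λ d → ends d ≡ (x , y) × ∀ β′ → blockOf d β′ ≡ β
  dartOf (inj₁ (zero , i)) (b , b′ , b≢b′ , p , q) with ≢⇒flip₂ b≢b′
  ... | refl = inj₂ (inj₁ (i , b)) , cong₂ _,_ p q , λ _ → refl
  dartOf (inj₂ (c , i)) (b , b′ , adj , p , q) with star-dart adj
  ... | d , refl , refl = inj₂ (inj₂ ((c , i) , d)) , cong₂ _,_ p q , λ _ → refl

  unique : ∀ {x y} β β′ → Edge x y β → Edge x y β′ → β ≡ β′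
  unique β β′ e e′ =
    let (d , p , r) = dartOf β e
        (d′ , p′ , r′) = dartOf β′ e′
    in trans (sym (r β)) (trans (cong (λ d → blockOf d β) (ends-injective (trans p (sym p′)))) (r′ β))

  edge : ∀ {x y} → x ≢ y → ∃ (Edge x y)
  edge {x} {y} x≢y with covE x y x≢y
  ... | inMatching i b p q = inj₁ (zero , i) , b , flip₂ b , ≢-flip₂ b , p , q
  ... | inStar c i d p q   = inj₂ (c , i) , tail d , head d , star-adjacent d , p , q

  dec : ∀ {x y} → x ≢ y → ∃ λ β → Edge x y β × (∀ {β′} → Edge x y β′ → β ≡ β′)
  dec x≢y = let (β , e) = edge x≢y in β , e , λ {β′} e′ → unique β β′ e e′

-- Residues modulo suc k

module Residues (k : ℕ) where

  private a = suc k

  infix 4 _≈_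
  -- A record, because `x` and `y` cannot be recovered by unification from `x % a ≡ y % a`.
  record _≈_ (x y : ℕ) : Set where
    constructor residue
    field
      residues : x % a ≡ y % a

  open _≈_ public

  ≈-reflexive : ∀ {x y} → x ≡ y → x ≈ y
  ≈-reflexive e = residue (cong (_% a) e)

  ≈-refl : ∀ {x} → x ≈ x
  ≈-refl = ≈-reflexive refl

  ≈-sym : ∀ {x y} → x ≈ y → y ≈ x
  ≈-sym e = residue (sym (residues e))

  ≈-trans : ∀ {x y z} → x ≈ y → y ≈ z → x ≈ z
  ≈-trans p q = residue (trans (residues p) (residues q))

  cls : ℕ → Fin a
  cls x = fromℕ< (m%n<n x a)

  toℕ-cls : ∀ x → toℕ (cls x) ≡ x % a
  toℕ-cls x = Finₚ.toℕ-fromℕ< (m%n<n x a)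

  cls-cong : ∀ {x y} → x ≈ y → cls x ≡ cls y
  cls-cong {x} {y} e = Finₚ.toℕ-injective (trans (toℕ-cls x) (trans (residues e) (sym (toℕ-cls y))))

  cls-injective : ∀ {x y} → cls x ≡ cls y → x ≈ y
  cls-injective {x} {y} e = residue (trans (sym (toℕ-cls x)) (trans (cong toℕ e) (toℕ-cls y)))

  cls-toℕ : ∀ i → cls (toℕ i) ≡ i
  cls-toℕ i = Finₚ.toℕ-injective (trans (toℕ-cls (toℕ i)) (m<n⇒m%n≡m (Finₚ.toℕ<n i)))

  toℕ-cls≈ : ∀ x → toℕ (cls x) ≈ x
  toℕ-cls≈ x = cls-injective (cls-toℕ (cls x))

  -- Certifies a congruence by an equation in which multiples of `a` are added on both sides, so no
  -- subtraction occurs.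
  wraps : ∀ {x y} p q → x + p * a ≡ y + q * a → x ≈ y
  wraps {x} {y} p q e = residue (trans (sym ([m+kn]%n≡m%n x p a)) (trans (cong (_% a) e) ([m+kn]%n≡m%n y q a)))

  +-cong-≈ : ∀ {x y u w} → x ≈ y → u ≈ w → x + u ≈ y + w
  +-cong-≈ {x} {y} {u} {w} p q = residue (trans (%-distribˡ-+ x u a)
    (trans (cong₂ (λ i j → (i + j) % a) (residues p) (residues q)) (sym (%-distribˡ-+ y w a))))

  +-congˡ-≈ : ∀ z {x y} → x ≈ y → z + x ≈ z + y
  +-congˡ-≈ z = +-cong-≈ (≈-refl {z})

  +-congʳ-≈ : ∀ z {x y} → x ≈ y → x + z ≈ y + z
  +-congʳ-≈ z e = +-cong-≈ e (≈-refl {z})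

  -- z * k represents - z, because suc k ≈ 0.
  +-neg-cancel : ∀ x z → x + z + z * k ≈ x
  +-neg-cancel x z = wraps 0 z (lemma x z k)
    where
    lemma : ∀ x z k → x + z + z * k + 0 * suc k ≡ x + z * suc k
    lemma = solve-∀

  neg-+-cancel : ∀ x z → x + z * k + z ≈ x
  neg-+-cancel x z = wraps 0 z (lemma x z k)
    where
    lemma : ∀ x z k → x + z * k + z + 0 * suc k ≡ x + z * suc k
    lemma = solve-∀

  difference : ∀ x y → x + (y + x * k) ≈ y
  difference x y = wraps 0 x (lemma x y k)
    where
    lemma : ∀ x y k → x + (y + x * k) + 0 * suc k ≡ y + x * suc k
    lemma = solve-∀

  +-cancelʳ-≈ : ∀ {x y} z → x + z ≈ y + z → x ≈ y
  +-cancelʳ-≈ {x} {y} z e =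
    ≈-trans (≈-sym (+-neg-cancel x z)) (≈-trans (+-congʳ-≈ (z * k) e) (+-neg-cancel y z))

  +-neg : ∀ {x y} z → x + z ≈ y → y + z * k ≈ x
  +-neg {x} z e = ≈-trans (+-congʳ-≈ (z * k) (≈-sym e)) (+-neg-cancel x z)

  small : ∀ {x y} → x < a → y < a → x ≈ y → x ≡ y
  small x<a y<a e = trans (sym (m<n⇒m%n≡m x<a)) (trans (residues e) (m<n⇒m%n≡m y<a))

-- A design on Fin (suc n) × ℤ/(suc k): q star classes that are translated by the cyclic group, and, for
-- every row r, f r classes consisting of the translates of a star having one leaf in each other row.

Row×ℕ : ℕ → Set
Row×ℕ n = Fin (suc n) × ℕ

module _ {n k q w : ℕ} (base : Fin q → Fin (suc k) → Fin (suc n) → Row×ℕ n) (match : Fin w → Fin 2 → Row×ℕ n) where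

  open Residues k

  -- `x + y′ ≈ x′ + y` states y′ - y = x′ - x without subtraction: some translate of the base edge
  -- then has the required ends. The matching is a single class and is not translated.
  data Joined (r : Fin (suc n)) (y : ℕ) (r′ : Fin (suc n)) (y′ : ℕ) : Set where
    arc     : ∀ p b i {x x′} → base p b zero ≡ (r , x) → base p b (suc i) ≡ (r′ , x′) →
              x + y′ ≈ x′ + y → Joined r y r′ y′
    arc⁻    : ∀ p b i {x x′} → base p b zero ≡ (r′ , x′) → base p b (suc i) ≡ (r , x) →
              x + y′ ≈ x′ + y → Joined r y r′ y′
    matched : ∀ c b {x x′} → match c b ≡ (r , x) → match c (flip₂ b) ≡ (r′ , x′) →
              x ≈ y → x′ ≈ y′ → Joined r y r′ y′

  -- The differences tgt i - src i, i < β, from row r to row r′ are realised by the base stars or the matching;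
  -- the remaining ones are left to the fixed stars.
  record Differences (f : Fin (suc n) → ℕ) (r r′ : Fin (suc n)) : Set where
    field
      {β}      : ℕ
      src tgt  : Fin β → ℕ
      distinct : ∀ {i j} → tgt i + src j ≈ tgt j + src i → i ≡ j
      total    : β + (f r + f r′) ≡ suc k
      joined   : ∀ i {y y′} → src i + y′ ≈ tgt i + y → Joined r y r′ y′

    diff : Fin β → Fin (suc k)
    diff i = cls (tgt i + src i * k)

    -- Adding `src i` and `src j` clears the negative terms and leaves the hypothesis of `distinct`.
    diff-injective : Injective _≡_ _≡_ diff
    diff-injective {i} {j} e = distinct
      (≈-trans (≈-sym (neg-+-cancel (tgt i + src j) (src i)))
      (≈-trans (≈-reflexive (lemma (tgt i) (src j) (src i * k) (src i)))
      (≈-trans (+-congʳ-≈ (src j + src i) (cls-injective {tgt i + src i * k} {tgt j + src j * k} e))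
      (≈-trans (≈-reflexive (lemma′ (tgt j) (src j * k) (src j) (src i))) (neg-+-cancel (tgt j + src i) (src j))))))
      where
      lemma : ∀ x y z w → x + y + z + w ≡ x + z + (y + w)
      lemma = solve-∀
      lemma′ : ∀ x y z w → x + y + (z + w) ≡ x + w + y + z
      lemma′ = solve-∀

  joined-sym : ∀ {r y r′ y′} → Joined r y r′ y′ → Joined r′ y′ r y
  joined-sym (arc p b i e e′ eq)  = arc⁻ p b i e e′ (≈-sym eq)
  joined-sym (arc⁻ p b i e e′ eq) = arc p b i e e′ (≈-sym eq)
  joined-sym (matched c zero e e′ x≈y x′≈y′)       = matched c (suc zero) e′ e x′≈y′ x≈y
  joined-sym (matched c (suc zero) e e′ x≈y x′≈y′) = matched c zero e′ e x′≈y′ x≈y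

  -- `f r` is the number of classes of fixed stars centred in row `r`, and `F` the length of an
  -- exhaustive list of them.
  record Design (F : ℕ) : Set where
    field
      f          : Fin (suc n) → ℕ
      f-listing  : Listing (Σ (Fin (suc n)) (Fin ∘ f)) F
      baseCovers : ∀ p r x → x < suc k → ∃ λ b → ∃ λ i → base p b i ≡ (r , x)
      matchCovers : ∀ r x → x < suc k → ∃ λ c → ∃ λ b → ∃ λ x′ → match c b ≡ (r , x′) × x′ ≈ x
      rows       : ∀ r {y y′} → y < y′ → y′ < suc k → Joined r y r y′
      pairs      : ∀ {r r′} → r Fin.< r′ → Differences f r r′

  module FromDesign {F : ℕ} (D : Design F) where
    open Design D

    -- Lists the differences from row `r` to row `r′` that are still missing. The first `f r` go to
    -- the classes centred in `r`, the last `f r′` to those centred in `r′`.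
    fill : ∀ {r r′} (p : r Fin.< r′) → Σ (Fin (f r + f r′) → Fin (suc k)) λ e →
           ∀ x → (∃ λ i → Differences.diff (pairs p) i ≡ x) ⊎ (∃ λ j → e j ≡ x)
    fill p = complement (Differences.diff (pairs p)) (Differences.diff-injective (pairs p)) (Differences.total (pairs p))

    -- The offset of the leaf in row `r′`. Seen from the later row the assigned difference changes
    -- sign, hence the factor `k`; the value 0 for `r` itself is a placeholder.
    out : ∀ r → Fin (f r) → Fin (suc n) → ℕ
    out r j r′ with r Finₚ.<? r′ | r′ Finₚ.<? r
    ... | yes p | _     = toℕ (proj₁ (fill p) (j ↑ˡ f r′))
    ... | no  _ | yes p = toℕ (proj₁ (fill p) (f r′ ↑ʳ j)) * k
    ... | no  _ | no  _ = 0

    out-< : ∀ {r r′} (p : r Fin.< r′) j → out r j r′ ≡ toℕ (proj₁ (fill p) (j ↑ˡ f r′))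
    out-< {r} {r′} p j with r Finₚ.<? r′ | r′ Finₚ.<? r
    ... | yes p′ | _ = cong (λ p → toℕ (proj₁ (fill p) (j ↑ˡ f r′))) (Finₚ.<-irrelevant p′ p)
    ... | no ¬p  | _ = ⊥-elim (¬p p)

    out-> : ∀ {r r′} (p : r Fin.< r′) j → out r′ j r ≡ toℕ (proj₁ (fill p) (f r ↑ʳ j)) * k
    out-> {r} {r′} p j with r′ Finₚ.<? r | r Finₚ.<? r′
    ... | yes p′ | _      = ⊥-elim (Finₚ.<-asym p′ p)
    ... | no _   | yes p′ = cong (λ p → toℕ (proj₁ (fill p) (f r ↑ʳ j)) * k) (Finₚ.<-irrelevant p′ p)
    ... | no _   | no ¬p  = ⊥-elim (¬p p)

    code : Row×ℕ n → Fin (suc n * suc k)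
    code (r , x) = combine r (cls x)

    code-onto : ∀ v → ∃ λ r → ∃ λ x → x < suc k × code (r , x) ≡ v
    code-onto v = let (r , x , p) = Finₚ.combine-surjective {suc n} {suc k} v in
      r , toℕ x , Finₚ.toℕ<n x , trans (cong (combine r) (cls-toℕ x)) p

    code-cong : ∀ r {x y} → x ≈ y → code (r , x) ≡ code (r , y)
    code-cong r e = cong (combine r) (cls-cong e)

    fixedStar : ∀ r → Fin (f r) → Fin (suc k) → Fin (suc n) → Row×ℕ n
    fixedStar r j t zero    = r , toℕ t
    fixedStar r j t (suc i) = punchIn r i , toℕ t + out r j (punchIn r i)

    ClassIndex : Set
    ClassIndex = (Fin q × Fin (suc k)) ⊎ Σ (Fin (suc n)) (Fin ∘ f)

    starIn : ClassIndex → Fin (suc k) → Fin (suc n) → Row×ℕ n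
    starIn (inj₁ (p , t)) b i = let (r , x) = base p b i in r , x + toℕ t
    starIn (inj₂ (r , j)) t i = fixedStar r j t i

    classes : Listing ClassIndex (q * suc k + F)
    classes = (Fin-listing q ×-listing Fin-listing (suc k)) ⊎-listing f-listing

    M : Fin w → Fin 2 → Fin (suc n * suc k)
    M c b = code (match c b)

    S : Fin (q * suc k + F) → Fin (suc k) → Fin (suc n) → Fin (suc n * suc k)
    S c i b = code (starIn (at classes c) i b)

    covM : ∀ v → ∃ λ c → ∃ λ b → M c b ≡ v
    covM v with code-onto v
    ... | r , x , x<a , refl = let (c , b , x′ , p , x′≈x) = matchCovers r x x<a in
      c , b , trans (cong code p) (code-cong r x′≈x)

    fixed-leaf : ∀ r j t r′ → r ≢ r′ → ∃ λ i → fixedStar r j t (suc i) ≡ (r′ , toℕ t + out r j r′)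
    fixed-leaf r j t r′ r≢r′ = punchOut r≢r′ ,
      cong (λ r′ → r′ , toℕ t + out r j r′) (Finₚ.punchIn-punchOut r≢r′)

    translation : ∀ x y → ∃ λ (t : Fin (suc k)) → x + toℕ t ≈ y
    translation x y = cls (y + x * k) , ≈-trans (+-congˡ-≈ x (toℕ-cls≈ (y + x * k))) (difference x y)

    covStar : ∀ c r x → x < suc k → ∃ λ i → ∃ λ b → code (starIn c i b) ≡ code (r , x)
    covStar (inj₁ (p , t)) r x x<a =
      let z = x + toℕ t * k
          (b , i , e) = baseCovers p r (toℕ (cls z)) (Finₚ.toℕ<n (cls z))
      in b , i , trans (cong (λ (r , x) → code (r , x + toℕ t)) e)
           (code-cong r (≈-trans (+-congʳ-≈ (toℕ t) (toℕ-cls≈ z)) (neg-+-cancel x (toℕ t))))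
    covStar (inj₂ (r , j)) r′ x x<a with r Finₚ.≟ r′
    ... | yes refl = cls x , zero , code-cong r (toℕ-cls≈ x)
    ... | no r≢r′ = let d = out r j r′
                        (t , e) = translation d x
                        (i , p) = fixed-leaf r j t r′ r≢r′
                    in t , suc i , trans (cong code p) (code-cong r′ (≈-trans (≈-reflexive (+-comm (toℕ t) d)) e))

    covS : ∀ c v → ∃ λ i → ∃ λ b → S c i b ≡ v
    covS c v with code-onto v
    ... | r , x , x<a , refl = covStar (at classes c) r x x<a

    Covered : Fin (suc n * suc k) → Fin (suc n * suc k) → Set
    Covered = CoveredEdge M S

    covered-sym : ∀ {x y} → Covered x y → Covered y x
    covered-sym (inMatching c zero p q)       = inMatching c (suc zero) q p
    covered-sym (inMatching c (suc zero) p q) = inMatching c zero q p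
    covered-sym (inStar c i (j , zero) p q)     = inStar c i (j , suc zero) q p
    covered-sym (inStar c i (j , suc zero) p q) = inStar c i (j , zero) q p

    star-covers : ∀ c i d {x y} → code (starIn c i (tail d)) ≡ x → code (starIn c i (head d)) ≡ y → Covered x y
    star-covers c i d p q with hit classes c
    ... | c′ , refl = inStar c′ i d p q

    translate : ∀ {x x′ y y′} t → x + t ≈ y → x + y′ ≈ x′ + y → x′ + t ≈ y′
    translate {x} {x′} {y} {y′} t e eq = +-cancelʳ-≈ y
      (≈-trans (≈-reflexive (swap-last x′ t y))
      (≈-trans (+-congʳ-≈ t (≈-sym eq))
      (≈-trans (≈-reflexive (swap-last x y′ t))
      (≈-trans (+-congʳ-≈ y′ e) (≈-reflexive (+-comm y y′))))))
      where
      swap-last : ∀ x y z → x + y + z ≡ x + z + y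
      swap-last = solve-∀

    joined⇒covered : ∀ {r y r′ y′} → Joined r y r′ y′ → Covered (code (r , y)) (code (r′ , y′))
    joined⇒covered {r} {y} {r′} {y′} (arc p b i {x} {x′} e e′ eq) =
      let (t , x+t≈y) = translation x y in
      star-covers (inj₁ (p , t)) b (i , zero)
        (trans (cong (λ (r , x) → code (r , x + toℕ t)) e) (code-cong r x+t≈y))
        (trans (cong (λ (r , x) → code (r , x + toℕ t)) e′) (code-cong r′ (translate (toℕ t) x+t≈y eq)))
    joined⇒covered {r} {y} {r′} {y′} (arc⁻ p b i {x} {x′} e e′ eq) =
      let (t , x+t≈y) = translation x y in
      star-covers (inj₁ (p , t)) b (i , suc zero)
        (trans (cong (λ (r , x) → code (r , x + toℕ t)) e′) (code-cong r x+t≈y))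
        (trans (cong (λ (r , x) → code (r , x + toℕ t)) e) (code-cong r′ (translate (toℕ t) x+t≈y eq)))
    joined⇒covered {r} {_} {r′} (matched c b e e′ x≈y x′≈y′) = inMatching c b
      (trans (cong code e) (code-cong r x≈y)) (trans (cong code e′) (code-cong r′ x′≈y′))

    fixed-covers : ∀ r j r′ → r ≢ r′ → ∀ {y y′} → y + out r j r′ ≈ y′ → Covered (code (r , y)) (code (r′ , y′))
    fixed-covers r j r′ r≢r′ {y} e =
      let (i , p) = fixed-leaf r j (cls y) r′ r≢r′ in
      star-covers (inj₂ (r , j)) (cls y) (i , zero)
        (code-cong r (toℕ-cls≈ y))
        (trans (cong code p) (code-cong r′ (≈-trans (+-congʳ-≈ (out r j r′) (toℕ-cls≈ y)) e)))

    -- The difference y′ - y is either realised by the base class or the matching, or listed by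
    -- `fill`; in the latter case the half of the list decides which row holds the centre.
    covered-< : ∀ {r r′} → r Fin.< r′ → ∀ y y′ → Covered (code (r , y)) (code (r′ , y′))
    covered-< {r} {r′} r<r′ y y′ with proj₂ (fill r<r′) (cls (y′ + y * k))
    ... | inj₁ (i , p) = joined⇒covered (joined i (+-cancelʳ-≈ (y * k)
            (≈-trans (≈-reflexive (+-assoc (src i) y′ (y * k)))
            (≈-trans (+-congˡ-≈ (src i) (≈-sym (cls-injective {tgt i + src i * k} {y′ + y * k} p)))
            (≈-trans (difference (src i) (tgt i)) (≈-sym (+-neg-cancel (tgt i) y)))))))
            where open Differences (pairs r<r′)
    ... | inj₂ (j , p) = byFixed (splitAt (f r) j) refl
      where
      e = proj₁ (fill r<r′)
      y+e≈y′ : y + toℕ (e j) ≈ y′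
      y+e≈y′ = ≈-trans (+-congˡ-≈ y (≈-trans (≈-reflexive (cong toℕ p)) (toℕ-cls≈ (y′ + y * k)))) (difference y y′)
      byFixed : ∀ s → splitAt (f r) j ≡ s → Covered (code (r , y)) (code (r′ , y′))
      byFixed (inj₁ i) eq = fixed-covers r i r′ (Finₚ.<⇒≢ r<r′)
        (≈-trans (≈-reflexive (cong (y +_) (trans (out-< r<r′ i) (cong (toℕ ∘ e) (Finₚ.splitAt⁻¹-↑ˡ eq))))) y+e≈y′)
      byFixed (inj₂ i) eq = covered-sym (fixed-covers r′ i r (Finₚ.<⇒≢ r<r′ ∘ sym)
        (≈-trans (≈-reflexive (cong (y′ +_) (trans (out-> r<r′ i) (cong (λ j → toℕ (e j) * k) (Finₚ.splitAt⁻¹-↑ʳ eq)))))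
          (+-neg (toℕ (e j)) y+e≈y′)))

    covE : ∀ x y → x ≢ y → Covered x y
    covE v v′ v≢v′ with code-onto v | code-onto v′
    ... | r , y , y<a , refl | r′ , y′ , y′<a , refl with Finₚ.<-cmp r r′
    ...   | tri< r<r′ _ _ = covered-< r<r′ y y′
    ...   | tri> _ _ r>r′ = covered-sym (covered-< r>r′ y′ y)
    ...   | tri≈ _ refl _ with <-cmp y y′
    ...     | tri< y<y′ _ _ = joined⇒covered (rows r y<y′ y′<a)
    ...     | tri> _ _ y>y′ = covered-sym (joined⇒covered (rows r y>y′ y<a))
    ...     | tri≈ _ refl _ = ⊥-elim (v≢v′ refl)

    -- The second equation is the count of ordered pairs divided by the row length `suc k`.
    designURD : w * 2 ≡ suc n * suc k →
      suc n * (suc n * suc k) ≡ 2 * suc n + (q * suc k + F) * (n * 2) →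
      URD (K 2) (Star n) (suc n * suc k) 1 (q * suc k + F)
    designURD w2 count = coveringURD M S w2 (*-comm (suc k) (suc n)) darts covM covS covE
      where
      v = suc n * suc k
      s = q * suc k + F
      lemma : ∀ n a s → suc n * a + (suc n * a + (s * a) * (n * 2)) ≡ (2 * suc n + s * (n * 2)) * a
      lemma = solve-∀
      lemma′ : ∀ n a → suc n * (suc n * a) * a ≡ (suc n * a) * (suc n * a)
      lemma′ = solve-∀
      darts : v + (w * 2 + (s * suc k) * (n * 2)) ≡ v * v
      darts = begin
        v + (w * 2 + (s * suc k) * (n * 2))  ≡⟨ cong (λ z → v + (z + (s * suc k) * (n * 2))) w2 ⟩
        v + (v + (s * suc k) * (n * 2))      ≡⟨ lemma n (suc k) s ⟩
        (2 * suc n + s * (n * 2)) * suc k    ≡⟨ cong (_* suc k) count ⟨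
        suc n * v * suc k                    ≡⟨ lemma′ n (suc k) ⟩
        v * v                                ∎
        where open ≡-Reasoning

-- Packing the row stars

opposite-sum : ∀ {n} (i : Fin n) → toℕ i + suc (toℕ (opposite i)) ≡ n
opposite-sum {n} i = begin
  toℕ i + suc (toℕ (opposite i))  ≡⟨ +-suc (toℕ i) _ ⟩
  suc (toℕ i) + toℕ (opposite i)  ≡⟨ cong (suc (toℕ i) +_) (Finₚ.opposite-prop i) ⟩
  suc (toℕ i) + (n ∸ suc (toℕ i)) ≡⟨ m+[n∸m]≡n (Finₚ.toℕ<n i) ⟩
  n                               ∎
  where open ≡-Reasoning

data Cut (p q : ℕ) : ℕ → Set where
  left  : (i : Fin p) → Cut p q (toℕ i)
  right : ∀ x → x < q → Cut p q (p + x)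

cut : ∀ p {q x} → x < p + q → Cut p q x
cut p {q} {x} x<p+q with x <? p
... | yes x<p = subst (Cut p q) (Finₚ.toℕ-fromℕ< x<p) (left (fromℕ< x<p))
... | no x≮p  = subst (Cut p q) (m+[n∸m]≡n (≮⇒≥ x≮p))
                  (right (x ∸ p) (+-cancelˡ-< p (x ∸ p) q (subst (_< p + q) (sym (m+[n∸m]≡n (≮⇒≥ x≮p))) x<p+q)))

grid : ∀ m n {x} → x < m * n → ∃ λ (i : Fin m) → ∃ λ (j : Fin n) → n * toℕ i + toℕ j ≡ x
grid m n x<mn = let (i , j , p) = Finₚ.combine-surjective {m} {n} (fromℕ< x<mn) in
  i , j , trans (sym (Finₚ.toℕ-combine i j)) (trans (cong toℕ p) (Finₚ.toℕ-fromℕ< x<mn))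

data EvenOdd (h₁ h₂ : ℕ) : ℕ → Set where
  even : (i : Fin h₁) → EvenOdd h₁ h₂ (2 * toℕ i)
  odd  : (i : Fin h₂) → EvenOdd h₁ h₂ (suc (2 * toℕ i))

evenOdd : ∀ h x → x < h → EvenOdd ⌈ h /2⌉ ⌊ h /2⌋ x
evenOdd (suc zero) zero x<h = even zero
evenOdd (suc zero) (suc x) (s≤s ())
evenOdd (suc (suc h)) zero x<h = even zero
evenOdd (suc (suc h)) (suc zero) x<h = odd zero
evenOdd (suc (suc h)) (suc (suc x)) (s≤s (s≤s x<h)) with evenOdd h x x<h
... | even i = subst (EvenOdd _ _) (cong suc (+-suc (toℕ i) (toℕ i + 0))) (even (suc i))
... | odd i  = subst (EvenOdd _ _) (cong (λ z → suc (suc z)) (+-suc (toℕ i) (toℕ i + 0))) (odd (suc i))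

-- With h = h₁ + h₂ stars, jumps μ + 1, …, μ + h n are split among stars i = 0, …, h - 1 by residue mod h.
-- The centres of the stars with i even lie just left of the block of leaves (separated by μ positions), in
-- decreasing order of i; the centres of the stars with i odd follow the block, in increasing order of i.
module Zigzag (n h₁ h₂ E₀ μ : ℕ) where

  h = h₁ + h₂
  -- The row of length `suc k` consists of position 0, `E₀` further positions, `h₁` left centres, a
  -- gap of `μ`, the `n * h` leaves and `μ` final positions.
  k = E₀ + (h₁ + (μ + (n * h + μ)))

  open Residues k

  RowStar : Set
  RowStar = Fin h₁ ⊎ Fin h₂

  leafAt : ℕ → ℕ
  leafAt x = suc E₀ + (h₁ + (μ + x))

  centre : RowStar → ℕ
  centre (inj₁ e) = suc E₀ + toℕ (opposite e)
  centre (inj₂ e) = suc (toℕ e)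

  -- The residue of the leaves within the block. From star i to star i + 2 the centre moves one step
  -- away from the block and the leaves one step farther from the centre, so jumps grow by 2.
  offset : RowStar → ℕ
  offset (inj₁ e) = toℕ e
  offset (inj₂ e) = h₁ + toℕ (opposite e)

  leaf : RowStar → Fin n → ℕ
  leaf s j = leafAt (h * toℕ j + offset s)

  leaves-covered : ∀ {x} → x < n * h → ∃ λ s → ∃ λ j → leaf s j ≡ leafAt x
  leaves-covered x<nh with grid n h x<nh
  ... | j , ρ , refl = go (cut h₁ (Finₚ.toℕ<n ρ))
    where
    go : ∀ {ρ} → Cut h₁ h₂ ρ → ∃ λ s → ∃ λ j′ → leaf s j′ ≡ leafAt (h * toℕ j + ρ)
    go (left e) = inj₁ e , j , refl
    go (right x x<h₂) = inj₂ (opposite (fromℕ< x<h₂)) , j ,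
      cong (λ x → leafAt (h * toℕ j + (h₁ + x)))
        (trans (cong toℕ (Finₚ.opposite-involutive (fromℕ< x<h₂))) (Finₚ.toℕ-fromℕ< x<h₂))

  left-centre : ∀ (e : Fin h₁) → centre (inj₁ (opposite e)) ≡ suc E₀ + toℕ e
  left-centre e = cong (λ e → suc E₀ + toℕ e) (Finₚ.opposite-involutive e)

  -- Write x = h j + i; star i realises the jump. For odd i the centre lies to the right of the
  -- block: leaves are counted from the right, hence `opposite j`, and the jump passes position 0,
  -- hence one wrap.
  jumps : (∀ i → i < h → EvenOdd h₁ h₂ i) → ∀ {x} → x < n * h → ∃ λ s → ∃ λ j →
          centre s + suc (μ + x) ≈ leaf s j ⊎ leaf s j + suc (μ + x) ≈ centre s
  jumps parity x<nh with grid n h x<nh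
  ... | j , i , refl = go (parity (toℕ i) (Finₚ.toℕ<n i))
    where
    even-jump : ∀ E μ h₂ hj e e′ h₁ → e + suc e′ ≡ h₁ →
      suc E + e′ + suc (μ + (hj + 2 * e)) ≡ suc E + (h₁ + (μ + (hj + e)))
    even-jump E μ h₂ hj e e′ h₁ refl = lemma E μ hj e e′
      where
      lemma : ∀ E μ hj e e′ → suc E + e′ + suc (μ + (hj + 2 * e)) ≡ suc E + (e + suc e′ + (μ + (hj + e)))
      lemma = solve-∀
    odd-jump : ∀ E μ h₁ e e′ h₂ j j′ n → e + suc e′ ≡ h₂ → j + suc j′ ≡ n →
      suc E + (h₁ + (μ + ((h₁ + h₂) * j′ + (h₁ + e′)))) + suc (μ + ((h₁ + h₂) * j + suc (2 * e))) + 0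
        ≡ suc e + suc (E + (h₁ + (μ + (n * (h₁ + h₂) + μ))))
    odd-jump E μ h₁ e e′ h₂ j j′ n refl refl = lemma E μ h₁ e e′ j j′
      where
      lemma : ∀ E μ h₁ e e′ j j′ →
        suc E + (h₁ + (μ + ((h₁ + (e + suc e′)) * j′ + (h₁ + e′)))) + suc (μ + ((h₁ + (e + suc e′)) * j + suc (2 * e))) + 0
        ≡ suc e + suc (E + (h₁ + (μ + ((j + suc j′) * (h₁ + (e + suc e′)) + μ))))
      lemma = solve-∀
    go : ∀ {i} → EvenOdd h₁ h₂ i → ∃ λ s → ∃ λ j′ →
         centre s + suc (μ + (h * toℕ j + i)) ≈ leaf s j′ ⊎ leaf s j′ + suc (μ + (h * toℕ j + i)) ≈ centre s
    go (even e) = inj₁ e , j , inj₁ (≈-reflexive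
      (even-jump E₀ μ h₂ (h * toℕ j) (toℕ e) (toℕ (opposite e)) h₁ (opposite-sum e)))
    go (odd e) = inj₂ e , opposite j , inj₂ (wraps 0 1 (trans
      (odd-jump E₀ μ h₁ (toℕ e) (toℕ (opposite e)) h₂ (toℕ j) (toℕ (opposite j)) n (opposite-sum e) (opposite-sum j))
      (cong (suc (toℕ e) +_) (sym (+-identityʳ (suc k))))))

-- Tools shared by the even and the odd design

+⇒≤ : ∀ {x y} d → x + d ≡ y → x ≤ y
+⇒≤ {x} d refl = m≤m+n x d

parallel : ∀ k → let open Residues k in ∀ {x x′ y y′ D} → x + D ≈ x′ → y + D ≈ y′ → x + y′ ≈ x′ + y
parallel k {x} {x′} {y} {y′} {D} p q =
  ≈-trans (+-congˡ-≈ x (≈-sym q)) (≈-trans (≈-reflexive (lemma x y D)) (+-congʳ-≈ y p))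
  where
  open Residues k
  lemma : ∀ x y D → x + (y + D) ≡ x + D + y
  lemma = solve-∀

splitAt-injective : ∀ m {n} {i j : Fin (m + n)} → splitAt m i ≡ splitAt m j → i ≡ j
splitAt-injective m {n} {i} {j} e = trans (sym (Finₚ.join-splitAt m n i)) (trans (cong (Fin.join m n) e) (Finₚ.join-splitAt m n j))

-- The difference `opposite i` - `i` is n - 1 - 2 i, which determines `i`.
opposite-crossing : ∀ {n} (i j : Fin n) → toℕ (opposite i) + toℕ j ≡ toℕ (opposite j) + toℕ i → i ≡ j
opposite-crossing i j e = Finₚ.toℕ-injective (lemma (toℕ i) (toℕ (opposite i)) (toℕ j) (toℕ (opposite j))
  (suc-injective (trans (sym (+-suc (toℕ i) _)) (trans (opposite-sum i) (trans (sym (opposite-sum j)) (+-suc (toℕ j) _))))) e)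
  where
  lemma : ∀ i i′ j j′ → i + i′ ≡ j + j′ → i′ + j ≡ j′ + i → i ≡ j
  lemma i i′ j j′ p q = *-cancelˡ-≡ i j 2 (+-cancelʳ-≡ (i′ + j′) (2 * i) (2 * j) (begin
    2 * i + (i′ + j′)      ≡⟨ r₁ i i′ j′ ⟩
    (i + i′) + (j′ + i)    ≡⟨ cong₂ _+_ p (sym q) ⟩
    (j + j′) + (i′ + j)    ≡⟨ r₂ j j′ i′ ⟩
    2 * j + (i′ + j′)      ∎))
    where
    open ≡-Reasoning
    r₁ : ∀ i i′ j′ → 2 * i + (i′ + j′) ≡ (i + i′) + (j′ + i)
    r₁ = solve-∀
    r₂ : ∀ j j′ i′ → (j + j′) + (i′ + j) ≡ 2 * j + (i′ + j′)
    r₂ = solve-∀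

-- With `p` positions after y′ = y + d + 1, a further p + y + 1 steps lead once round the row to
-- `y`: a long jump is replaced by the complementary short one.
around : ∀ y d p a → suc (suc y + d) + p ≡ a → suc y + d + suc (p + y) + 0 ≡ y + (a + 0)
around y d p a refl = lemma y d p
  where
  lemma : ∀ y d p → suc y + d + suc (p + y) + 0 ≡ y + (suc (suc y + d) + p + 0)
  lemma = solve-∀

-- Both sums stay below 2 ℓ, so after cancelling `c + c` the congruence is an equality.
opposite-crossing-≈ : ∀ k c {ℓ} → ℓ + ℓ ≤ suc k → (i j : Fin ℓ) → let open Residues k in
  (c + toℕ (opposite i)) + (c + toℕ j) ≈ (c + toℕ (opposite j)) + (c + toℕ i) → i ≡ j
opposite-crossing-≈ k c {ℓ} 2ℓ≤a i j e = opposite-crossing i j (small (bound i j) (bound j i)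
  (+-cancelʳ-≈ (c + c) (≈-trans (≈-reflexive (lemma c (toℕ (opposite i)) (toℕ j)))
    (≈-trans e (≈-reflexive (sym (lemma c (toℕ (opposite j)) (toℕ i))))))))
  where
  open Residues k
  lemma : ∀ c x y → x + y + (c + c) ≡ (c + x) + (c + y)
  lemma = solve-∀
  bound : ∀ (i j : Fin ℓ) → toℕ (opposite i) + toℕ j < suc k
  bound i j = <-≤-trans (+-mono-< (Finₚ.toℕ<n (opposite i)) (Finₚ.toℕ<n j)) 2ℓ≤a

-- Row 0 holds the centres of all cross stars of the base class, so its number of fixed classes
-- differs from that of the other rows.
firstRow : ℕ → ℕ → ∀ {n} → Fin (suc n) → ℕ
firstRow p q zero    = p
firstRow p q (suc r) = q

firstRow-listing : ∀ p q {n} → Listing (Σ (Fin (suc n)) (Fin ∘ firstRow p q)) (p + n * q)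
firstRow-listing p q {n} =
  image-listing to-Σ to-Σ-onto (Fin-listing p ⊎-listing (Fin-listing n ×-listing Fin-listing q))
  where
  to-Σ : Fin p ⊎ (Fin n × Fin q) → Σ (Fin (suc n)) (Fin ∘ firstRow p q)
  to-Σ (inj₁ j)       = zero , j
  to-Σ (inj₂ (r , j)) = suc r , j
  to-Σ-onto : ∀ y → ∃ λ x → to-Σ x ≡ y
  to-Σ-onto (zero , j)  = inj₁ j , refl
  to-Σ-onto (suc r , j) = inj₂ (r , j) , refl

-- The design for even q > 0

-- q = 2 (h₁ + h₂) > 0.  Along a row: position 0, right zigzag centres, the positions R, left zigzag centres
-- preceded by the position last, zigzag leaves.
module EvenDesign (m′ g₁ h₂ : ℕ) (parity : ∀ i → i < suc g₁ + h₂ → EvenOdd (suc g₁) h₂ i) where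

  n h₁ ℓ E₀ : ℕ
  n = suc (m′ * 2)
  h₁ = suc g₁
  ℓ = (h₁ + h₂) * (m′ * 2)
  E₀ = h₂ + (ℓ + 1)

  open Zigzag n h₁ h₂ E₀ 0 public
  open Residues k

  half : ℕ
  half = suc (n * h)

  halves : half + half ≡ suc k
  halves = lemma m′ h₁ h₂
    where
    lemma : ∀ m′ h₁ h₂ → let n = suc (m′ * 2) ; h = h₁ + h₂ ; ℓ = h * (m′ * 2) in
      suc (n * h) + suc (n * h) ≡ suc (h₂ + (ℓ + 1) + (h₁ + (n * h + 0)))
    lemma = solve-∀

  R : Fin ℓ → ℕ
  R j = suc (h₂ + toℕ j)

  last : ℕ
  last = suc (h₂ + ℓ)

  -- One star for each position outside the zigzag. The positions `R` are reversed, and 0 and `last`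
  -- exchanged, between row 0 and the other rows; this keeps the differences distinct.
  CrossStar : Set
  CrossStar = Fin ℓ ⊎ Fin 2

  -- position in row 0 and in the other rows
  from to : CrossStar → ℕ
  from (inj₁ j) = R j
  from (inj₂ zero) = 0
  from (inj₂ (suc zero)) = last
  to (inj₁ j) = R (opposite j)
  to (inj₂ zero) = last
  to (inj₂ (suc zero)) = 0

  BaseStar : Set
  BaseStar = (Fin (suc n) × RowStar) ⊎ CrossStar

  star : BaseStar → Fin (suc n) → Row×ℕ n
  star (inj₁ (r , s)) zero    = r , centre s
  star (inj₁ (r , s)) (suc i) = r , leaf s i
  star (inj₂ c)       zero    = zero , from c
  star (inj₂ c)       (suc i) = suc i , to c

  abstract
    stars-count : suc n * (h₁ + h₂) + (ℓ + 2) ≡ suc k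
    stars-count = lemma m′ h₁ h₂
      where
      lemma : ∀ m′ h₁ h₂ → let n = suc (m′ * 2) ; h = h₁ + h₂ ; ℓ = h * (m′ * 2) in
        suc n * (h₁ + h₂) + (ℓ + 2) ≡ suc (h₂ + (ℓ + 1) + (h₁ + (n * h + 0)))
      lemma = solve-∀

  stars : Listing BaseStar (suc k)
  stars = subst (Listing BaseStar) stars-count
    ((Fin-listing (suc n) ×-listing (Fin-listing h₁ ⊎-listing Fin-listing h₂)) ⊎-listing
     (Fin-listing ℓ ⊎-listing Fin-listing 2))

  Pair : Set
  Pair = Fin (suc n) × Fin half

  pairEnd : Pair → Fin 2 → Row×ℕ n
  pairEnd (r , i) zero       = r , toℕ i
  pairEnd (r , i) (suc zero) = r , half + toℕ i

  pairList : Listing Pair (suc n * half)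
  pairList = Fin-listing (suc n) ×-listing Fin-listing half

  base : Fin 1 → Fin (suc k) → Fin (suc n) → Row×ℕ n
  base _ b = star (at stars b)

  match : Fin (suc n * half) → Fin 2 → Row×ℕ n
  match c = pairEnd (at pairList c)

  Adjacent : Fin (suc n) → ℕ → Fin (suc n) → ℕ → Set
  Adjacent = Joined base match

  star-arc : ∀ s i {r x r′ x′ y y′} → star s zero ≡ (r , x) → star s (suc i) ≡ (r′ , x′) →
    x + y′ ≈ x′ + y → Adjacent r y r′ y′
  star-arc s i e e′ eq with hit stars s
  ... | b , refl = arc zero b i e e′ eq

  covers : ∀ r x → x < suc k → ∃ λ s → ∃ λ i → star s i ≡ (r , x)
  covers r x x<a with cut (suc E₀) x<a
  ... | left i = early (cut 1 (Finₚ.toℕ<n i))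
    where
    -- A position is a centre in row 0 but a leaf, usually of another star, in the remaining rows.
    cross-onto : ∀ c c′ → to c ≡ from c′ → ∃ λ s → ∃ λ i → star s i ≡ (r , from c′)
    cross-onto c c′ e = go r
      where
      go : ∀ r → ∃ λ s → ∃ λ i → star s i ≡ (r , from c′)
      go zero    = inj₂ c′ , zero , refl
      go (suc r) = inj₂ c , suc r , cong (suc r ,_) e
    early : ∀ {x} → Cut 1 E₀ x → ∃ λ s → ∃ λ i → star s i ≡ (r , x)
    early (left zero) = cross-onto (inj₂ (suc zero)) (inj₂ zero) refl
    early (right _ x<E₀) with cut h₂ x<E₀
    ... | left e = inj₁ (r , inj₂ e) , zero , refl
    ... | right _ x<ℓ+1 with cut ℓ x<ℓ+1
    ...   | left j = cross-onto (inj₁ (opposite j)) (inj₁ j) (cong R (Finₚ.opposite-involutive j))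
    ...   | right zero _ = subst (λ x → ∃ λ s → ∃ λ i → star s i ≡ (r , x))
                             (cong (λ z → suc (h₂ + z)) (sym (+-identityʳ ℓ))) (cross-onto (inj₂ zero) (inj₂ (suc zero)) refl)
    ...   | right (suc _) (s≤s ())
  ... | right _ x<′ with cut h₁ x<′
  ...   | left e = inj₁ (r , inj₁ (opposite e)) , zero , cong (r ,_) (left-centre e)
  ...   | right x x<″ = let (s , j , p) = leaves-covered (subst (x <_) (+-identityʳ (n * h)) x<″) in
            inj₁ (r , s) , suc j , cong (r ,_) p

  2ℓ+_≤a : ∀ x → x ≤ 2 + 2 * h → ℓ + ℓ + x ≤ suc k
  2ℓ+ x ≤a x≤ = ≤-trans (+-monoʳ-≤ (ℓ + ℓ) x≤) (≤-reflexive (lemma m′ h₁ h₂))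
    where
    lemma : ∀ m′ h₁ h₂ → let n = suc (m′ * 2) ; h = h₁ + h₂ ; ℓ = h * (m′ * 2) in
      ℓ + ℓ + (2 + 2 * h) ≡ suc (h₂ + (ℓ + 1) + (h₁ + (n * h + 0)))
    lemma = solve-∀

  2ℓ≤a : ℓ + ℓ ≤ suc k
  2ℓ≤a = ≤-trans (≤-reflexive (sym (+-identityʳ (ℓ + ℓ)))) (2ℓ+ 0 ≤a z≤n)

  -- Separates the differences inside `R` from plus or minus `last`: after cancelling, both sides
  -- are reduced residues, and the left one exceeds ℓ.
  inner≢outer : ∀ (i j : Fin ℓ) → ¬ last + R i ≈ R j
  inner≢outer i j e = m+1+n≰m ℓ (begin
    ℓ + suc (h₂ + toℕ i)       ≡⟨ lemma h₂ ℓ (toℕ i) ⟩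
    suc (h₂ + ℓ + toℕ i)       ≡⟨ small low (<-≤-trans (Finₚ.toℕ<n j) (≤-trans (m≤m+n ℓ ℓ) 2ℓ≤a)) cancelled ⟩
    toℕ j                      ≤⟨ <⇒≤ (Finₚ.toℕ<n j) ⟩
    ℓ                          ∎)
    where
    open ≤-Reasoning
    lemma : ∀ h₂ ℓ i → ℓ + suc (h₂ + i) ≡ suc (h₂ + ℓ + i)
    lemma = solve-∀
    lemma′ : ∀ h₂ ℓ i → suc (h₂ + ℓ + i) + suc h₂ ≡ suc (h₂ + ℓ) + suc (h₂ + i)
    lemma′ = solve-∀
    cancelled : suc (h₂ + ℓ + toℕ i) ≈ toℕ j
    cancelled = +-cancelʳ-≈ (suc h₂) (≈-trans (≈-reflexive (lemma′ h₂ ℓ (toℕ i)))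
      (≈-trans e (≈-reflexive (+-comm (suc h₂) (toℕ j)))))
    low : suc (h₂ + ℓ + toℕ i) < suc k
    low = begin-strict
      suc (h₂ + ℓ + toℕ i)  <⟨ s<s (+-monoʳ-< (h₂ + ℓ) (Finₚ.toℕ<n i)) ⟩
      suc (h₂ + ℓ + ℓ)      ≡⟨ lemma″ h₂ ℓ ⟩
      ℓ + ℓ + suc h₂        ≤⟨ 2ℓ+ suc h₂ ≤a (s≤s (≤-trans (m≤n+m h₂ h₁) (≤-trans (m≤m+n h (h + 0)) (n≤1+n _)))) ⟩
      suc k                 ∎
      where
      lemma″ : ∀ h₂ ℓ → suc (h₂ + ℓ + ℓ) ≡ ℓ + ℓ + suc h₂
      lemma″ = solve-∀

  -- Separates `last` from its negative. Twice `last` stays below the row length because at least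
  -- one star is centred on the left.
  last+last≉0 : ¬ last + last ≈ 0
  last+last≉0 e = case small low (s≤s z≤n) e of λ ()
    where
    lemma : ∀ h₂ ℓ → suc (suc (h₂ + ℓ) + suc (h₂ + ℓ)) ≡ ℓ + ℓ + (3 + 2 * h₂)
    lemma = solve-∀
    lemma′ : ∀ g₁ h₂ → 3 + 2 * h₂ + suc (2 * g₁) ≡ 2 + 2 * (suc g₁ + h₂)
    lemma′ = solve-∀
    low : last + last < suc k
    low = ≤-trans (≤-reflexive (lemma h₂ ℓ)) (2ℓ+ 3 + 2 * h₂ ≤a (+⇒≤ (suc (2 * g₁)) (lemma′ g₁ h₂)))

  crossings-distinct : ∀ c c′ → to c + from c′ ≈ to c′ + from c → c ≡ c′
  crossings-distinct (inj₁ i) (inj₁ j) e = cong inj₁ (opposite-crossing-≈ k (suc h₂) 2ℓ≤a i j e)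
  crossings-distinct (inj₁ i) (inj₂ zero) e = ⊥-elim (inner≢outer i (opposite i) (≈-trans (≈-sym e) (≈-reflexive (+-identityʳ _))))
  crossings-distinct (inj₁ i) (inj₂ (suc zero)) e =
    ⊥-elim (inner≢outer (opposite i) i (≈-trans (≈-reflexive (+-comm last (R (opposite i)))) e))
  crossings-distinct (inj₂ zero) (inj₁ i) e = ⊥-elim (inner≢outer i (opposite i) (≈-trans e (≈-reflexive (+-identityʳ _))))
  crossings-distinct (inj₂ (suc zero)) (inj₁ i) e =
    ⊥-elim (inner≢outer (opposite i) i (≈-trans (≈-reflexive (+-comm last (R (opposite i)))) (≈-sym e)))
  crossings-distinct (inj₂ zero) (inj₂ zero) e = refl
  crossings-distinct (inj₂ zero) (inj₂ (suc zero)) e = ⊥-elim (last+last≉0 e)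
  crossings-distinct (inj₂ (suc zero)) (inj₂ zero) e = ⊥-elim (last+last≉0 (≈-sym e))
  crossings-distinct (inj₂ (suc zero)) (inj₂ (suc zero)) e = refl

  design : Design base match (g₁ + h₂ + n * half)
  design = record
    -- Two rows other than row 0 meet only in fixed stars, hence `half` for each; against row 0 the
    -- ℓ + 2 cross stars leave `g₁ + h₂`.
    { f = firstRow (g₁ + h₂) half
    ; f-listing = firstRow-listing (g₁ + h₂) half
    ; baseCovers = λ _ r x x<a → let (s , i , p) = covers r x x<a ; (b , q) = hit stars s in
        b , i , trans (cong (λ s → star s i) q) p
    ; matchCovers = matchCovers
    ; rows = rows
    ; pairs = pairs }
    where
    pair-hit : ∀ p b {r x} → pairEnd p b ≡ (r , x) → ∃ λ c → ∃ λ b → ∃ λ x′ → match c b ≡ (r , x′) × x′ ≈ x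
    pair-hit p b e with hit pairList p
    ... | c , refl = c , b , _ , e , ≈-refl

    matchCovers : ∀ r x → x < suc k → ∃ λ c → ∃ λ b → ∃ λ x′ → match c b ≡ (r , x′) × x′ ≈ x
    matchCovers r x x<a with cut half (subst (x <_) (sym halves) x<a)
    ... | left i = pair-hit (r , i) zero refl
    ... | right x x<h = pair-hit (r , fromℕ< x<h) (suc zero) (cong (λ x → r , half + x) (Finₚ.toℕ-fromℕ< x<h))

    antipodal : ∀ r {y} → y < half → Adjacent r y r (half + y)
    antipodal r {y} y<h with hit pairList (r , fromℕ< y<h)
    ... | c , e = matched c zero (cong (λ p → pairEnd p zero) e) (cong (λ p → pairEnd p (suc zero)) e)
            (≈-reflexive (Finₚ.toℕ-fromℕ< y<h)) (≈-reflexive (cong (half +_) (Finₚ.toℕ-fromℕ< y<h)))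

    jump : ∀ r {x} → x < n * h → ∀ {y y′} → y + suc x ≈ y′ → Adjacent r y r y′
    jump r x<nh p with jumps parity x<nh
    ... | s , j , inj₁ e = star-arc (inj₁ (r , s)) j refl refl (parallel k e p)
    ... | s , j , inj₂ e = joined-sym base match (star-arc (inj₁ (r , s)) j refl refl (≈-sym (parallel k e p)))

    rows : ∀ r {y y′} → y < y′ → y′ < suc k → Adjacent r y r y′
    rows r {y} {y′} y<y′ y′<a with m≤n⇒∃[o]m+o≡n y<y′
    -- Distances below `half` are zigzag jumps, `half` itself belongs to the matching, and larger
    -- ones are complements of jumps.
    ... | d , refl with <-cmp d (n * h)
    ...   | tri< d<nh _ _ = jump r d<nh (≈-reflexive (+-suc y d))
    ...   | tri≈ _ refl _ = subst (Adjacent r y r) (trans (+-comm half y) (+-suc y (n * h))) (antipodal r y<half)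
            where
            y<half : y < half
            y<half = +-cancelʳ-< half y half (subst₂ _<_ (sym (+-suc y d)) (sym halves) y′<a)
    ...   | tri> _ _ d>nh with m≤n⇒∃[o]m+o≡n y′<a | m≤n⇒∃[o]m+o≡n d>nh
    ...     | p , y′+p | o , refl = joined-sym base match (jump r p+y<nh (wraps 0 1 (around y d p _ y′+p)))
            where
            p+y<nh : p + y < n * h
            p+y<nh = +⇒≤ o (suc-injective (+-cancelʳ-≡ half (suc (suc (p + y) + o)) half
              (trans (lemma p y o half) (trans y′+p (sym halves)))))
              where
              lemma : ∀ p y o half → suc (suc (p + y) + o) + half ≡ suc (suc y + (half + o)) + p
              lemma = solve-∀

    pairs : ∀ {r r′} → r Fin.< r′ → Differences base match (firstRow (g₁ + h₂) half) r r′
    pairs {zero} {suc r} _ = record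
      { β = ℓ + 2
      ; src = from ∘ splitAt ℓ
      ; tgt = to ∘ splitAt ℓ
      ; distinct = λ {i} {j} e → splitAt-injective ℓ (crossings-distinct (splitAt ℓ i) (splitAt ℓ j) e)
      ; total = total m′ g₁ h₂
      ; joined = λ i → star-arc (inj₂ (splitAt ℓ i)) r refl refl }
      where
      total : ∀ m′ g₁ h₂ → let n = suc (m′ * 2) ; h = suc g₁ + h₂ ; ℓ = h * (m′ * 2) in
        ℓ + 2 + (g₁ + h₂ + suc (n * h)) ≡ suc (h₂ + (ℓ + 1) + (suc g₁ + (n * h + 0)))
      total = solve-∀
    pairs {suc r} {suc r′} _ = record
      { β = 0 ; src = λ () ; tgt = λ () ; distinct = λ { {()} } ; total = halves ; joined = λ () }

  urd : URD (K 2) (Star n) (suc n * suc k) 1 (1 * suc k + (g₁ + h₂ + n * half))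
  urd = FromDesign.designURD base match design (matchings half (suc k) halves n) (count m′ g₁ h₂)
    where
    matchings : ∀ b a → b + b ≡ a → ∀ n → suc n * b * 2 ≡ suc n * a
    matchings b a refl n = lemma n b
      where
      lemma : ∀ n b → suc n * b * 2 ≡ suc n * (b + b)
      lemma = solve-∀
    count : ∀ m′ g₁ h₂ →
      let n = suc (m′ * 2) ; h = suc g₁ + h₂ ; ℓ = h * (m′ * 2) ; k = h₂ + (ℓ + 1) + (suc g₁ + (n * h + 0)) in
      suc n * (suc n * suc k) ≡ 2 * suc n + (1 * suc k + (g₁ + h₂ + n * suc (n * h))) * (n * 2)
    count = solve-∀

-- The design for odd q

flip₂-involutive : ∀ b → flip₂ (flip₂ b) ≡ b
flip₂-involutive zero       = refl
flip₂-involutive (suc zero) = refl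

-- Row (i , X) sends arcs to the rows (i′ , side i i′ X) with i′ ≢ i: an orientation, with all in- and out-degrees
-- equal, of the complete graph on Fin m × Fin 2 without the edges {(i , 0) , (i , 1)}, which carry the matching.
side : ∀ {m} → Fin m → Fin m → Fin 2 → Fin 2
side i i′ X with i Finₚ.<? i′
... | yes _ = X
... | no  _ = flip₂ X

side-involutive : ∀ {m} (i i′ : Fin m) X → side i i′ (side i i′ X) ≡ X
side-involutive i i′ X with i Finₚ.<? i′
... | yes _ = refl
... | no  _ = flip₂-involutive X

side-< : ∀ {m} {i i′ : Fin m} → i Fin.< i′ → ∀ X → side i i′ X ≡ X
side-< {i = i} {i′} i<i′ X with i Finₚ.<? i′
... | yes _ = refl
... | no i≮i′ = ⊥-elim (i≮i′ i<i′)

side-> : ∀ {m} {i i′ : Fin m} → i Fin.> i′ → ∀ X → side i i′ X ≡ flip₂ X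
side-> {i = i} {i′} i>i′ X with i Finₚ.<? i′
... | yes i<i′ = ⊥-elim (Finₚ.<-asym i<i′ i>i′)
... | no _ = refl

module OddCounts where

  halves : ∀ m′ h₁ h₂ → let n = suc (m′ * 2) ; h = h₁ + h₂ ; ℓ = h * (m′ * 2) ; m = suc m′ in
    1 + (n * h + m + (n * h + m)) ≡ suc (h₂ + ℓ + (h₁ + (m + (n * h + m))))
  halves = solve-∀

  T-start : ∀ m′ h₁ h₂ → let n = suc (m′ * 2) ; h = h₁ + h₂ ; ℓ = h * (m′ * 2) in
    suc (h₂ + ℓ) + h₁ ≡ suc (n * h)
  T-start = solve-∀

  stars : ∀ m′ h₁ h₂ → let n = suc (m′ * 2) ; h = h₁ + h₂ ; ℓ = h * (m′ * 2) ; m = suc m′ in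
    suc n * (h₁ + h₂) + (suc n + (ℓ + 1)) ≡ suc (h₂ + ℓ + (h₁ + (m + (n * h + m))))
  stars = solve-∀

  leaves : ∀ m′ → suc m′ + m′ ≡ suc (m′ * 2)
  leaves = solve-∀

  classes : ∀ m′ h₁ h₂ → let n = suc (m′ * 2) ; h = h₁ + h₂ ; ℓ = h * (m′ * 2) ; m = suc m′ in
    suc (ℓ + 1) + (h + m′ + (n * h + m)) ≡ suc (h₂ + ℓ + (h₁ + (m + (n * h + m))))
  classes = solve-∀

  total : ∀ m′ h₁ h₂ →
    let n = suc (m′ * 2) ; h = h₁ + h₂ ; ℓ = h * (m′ * 2) ; m = suc m′ ; k = h₂ + ℓ + (h₁ + (m + (n * h + m))) in
    suc n * (suc n * suc k) ≡ 2 * suc n + (1 * suc k + (h + m′ + n * (n * h + m))) * (n * 2)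
  total = solve-∀

-- q = 2 (h₁ + h₂) + 1 and m = (n+1)/2.  Along a row: the centre 0 of the mixed star, right zigzag centres, the
-- positions R, left zigzag centres, the positions T where the row receives arcs, zigzag leaves, near leaves of
-- the mixed star.
module OddDesign (m′ h₁ h₂ : ℕ) (parity : ∀ i → i < h₁ + h₂ → EvenOdd h₁ h₂ i) where

  n m ℓ E₀ : ℕ
  n = suc (m′ * 2)
  m = suc m′
  ℓ = (h₁ + h₂) * (m′ * 2)
  E₀ = h₂ + ℓ

  open Zigzag n h₁ h₂ E₀ m public
  open Residues k

  maxJump : ℕ
  maxJump = n * h + m

  abstract
    halves : 1 + (maxJump + maxJump) ≡ suc k
    halves = OddCounts.halves m′ h₁ h₂

    T-start : suc E₀ + h₁ ≡ suc (n * h)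
    T-start = OddCounts.T-start m′ h₁ h₂

  R T : ℕ → ℕ
  R j = suc (h₂ + j)
  T s = suc E₀ + (h₁ + s)

  nearLeaf : ℕ → ℕ
  nearLeaf j = suc E₀ + (h₁ + (m + (n * h + j)))

  row : Fin m → Fin 2 → Fin (suc n)
  row = combine

  -- The slot is the rank of `i` among the indices other than `i′`, so the m′ arcs into a row land
  -- in distinct slots and leave `T m′` free.
  send : ∀ i i′ → i ≢ i′ → Fin 2 → Row×ℕ n
  send i i′ i≢i′ X = row i′ (side i i′ X) , T (toℕ (punchOut (i≢i′ ∘ sym)))

  crossLeaf : Fin m × Fin 2 → Fin m′ → Row×ℕ n
  crossLeaf (i , X) j = send i (punchIn i j) (Finₚ.punchInᵢ≢i i j ∘ sym) X

  mixedLeaf : Fin (suc n) → Fin m ⊎ Fin m′ → Row×ℕ n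
  mixedLeaf r (inj₁ j) = r , nearLeaf (toℕ j)
  mixedLeaf r (inj₂ j) = crossLeaf (remQuot {m} 2 r) j

  abstract
    leaves-count : m + m′ ≡ n
    leaves-count = OddCounts.leaves m′

  mixedLeaves : Listing (Fin m ⊎ Fin m′) n
  mixedLeaves = subst (Listing _) leaves-count (Fin-listing m ⊎-listing Fin-listing m′)

  -- The last star has all its vertices at the slot `T m′`, which receives no arc; it realises the
  -- difference 0.
  CrossStar : Set
  CrossStar = Fin ℓ ⊎ Fin 1

  from to : CrossStar → ℕ
  from (inj₁ j) = R (toℕ j)
  from (inj₂ _) = T m′
  to (inj₁ j) = R (toℕ (opposite j))
  to (inj₂ _) = T m′

  BaseStar : Set
  BaseStar = (Fin (suc n) × RowStar) ⊎ Fin (suc n) ⊎ CrossStar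

  star : BaseStar → Fin (suc n) → Row×ℕ n
  star (inj₁ (r , s))  zero    = r , centre s
  star (inj₁ (r , s))  (suc i) = r , leaf s i
  star (inj₂ (inj₁ r)) zero    = r , 0
  star (inj₂ (inj₁ r)) (suc i) = mixedLeaf r (at mixedLeaves i)
  star (inj₂ (inj₂ c)) zero    = zero , from c
  star (inj₂ (inj₂ c)) (suc i) = suc i , to c

  abstract
    stars-count : suc n * (h₁ + h₂) + (suc n + (ℓ + 1)) ≡ suc k
    stars-count = OddCounts.stars m′ h₁ h₂

  stars : Listing BaseStar (suc k)
  stars = subst (Listing BaseStar) stars-count
    ((Fin-listing (suc n) ×-listing (Fin-listing h₁ ⊎-listing Fin-listing h₂)) ⊎-listing
     (Fin-listing (suc n) ⊎-listing (Fin-listing ℓ ⊎-listing Fin-listing 1)))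

  -- Partner rows are matched with the shift `T 0`, so that this difference has the same form as
  -- that of a tournament arc.
  pairEnd : Fin m × Fin (suc k) → Fin 2 → Row×ℕ n
  pairEnd (i , y) zero       = row i zero , toℕ y
  pairEnd (i , y) (suc zero) = row i (suc zero) , toℕ y + T 0

  pairList : Listing (Fin m × Fin (suc k)) (m * suc k)
  pairList = Fin-listing m ×-listing Fin-listing (suc k)

  base : Fin 1 → Fin (suc k) → Fin (suc n) → Row×ℕ n
  base _ b = star (at stars b)

  match : Fin (m * suc k) → Fin 2 → Row×ℕ n
  match c = pairEnd (at pairList c)

  Adjacent : Fin (suc n) → ℕ → Fin (suc n) → ℕ → Set
  Adjacent = Joined base match

  star-arc : ∀ s i {r x r′ x′ y y′} → star s zero ≡ (r , x) → star s (suc i) ≡ (r′ , x′) →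
    x + y′ ≈ x′ + y → Adjacent r y r′ y′
  star-arc s i e e′ eq with hit stars s
  ... | b , refl = arc zero b i e e′ eq

  mixed-hit : ∀ r j → ∃ λ i → star (inj₂ (inj₁ r)) (suc i) ≡ mixedLeaf r j
  mixed-hit r j = let (i , p) = hit mixedLeaves j in i , cong (mixedLeaf r) p

  send-cong : ∀ i {i′ i″} (p : i ≢ i′) (q : i ≢ i″) X → i′ ≡ i″ → send i i′ p X ≡ send i i″ q X
  send-cong i {i′} p q X refl = cong (λ s → row i′ (side i i′ X) , T (toℕ s))
    (Finₚ.punchOut-cong i′ {i≢j = p ∘ sym} {i≢k = q ∘ sym} refl)

  sends : ∀ i i′ (i≢i′ : i ≢ i′) X → ∃ λ j → star (inj₂ (inj₁ (row i X))) (suc j) ≡ send i i′ i≢i′ X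
  sends i i′ i≢i′ X =
    let (j , p) = mixed-hit (row i X) (inj₂ (punchOut i≢i′)) in
    j , trans p (trans (cong (λ q → crossLeaf q (punchOut i≢i′)) (Finₚ.remQuot-combine i X))
          (send-cong i (Finₚ.punchInᵢ≢i i (punchOut i≢i′) ∘ sym) i≢i′ X (Finₚ.punchIn-punchOut i≢i′)))

  covers : ∀ r x → x < suc k → ∃ λ s → ∃ λ i → star s i ≡ (r , x)
  covers r x x<a with cut (suc E₀) x<a
  ... | left i = early (cut 1 (Finₚ.toℕ<n i))
    where
    early : ∀ {x} → Cut 1 E₀ x → ∃ λ s → ∃ λ i → star s i ≡ (r , x)
    early (left zero) = inj₂ (inj₁ r) , zero , refl
    early (right _ x<E₀) with cut h₂ x<E₀
    ... | left e = inj₁ (r , inj₂ e) , zero , refl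
    ... | right x x<ℓ = go r
      where
      j = fromℕ< x<ℓ
      go : ∀ r → ∃ λ s → ∃ λ i → star s i ≡ (r , R x)
      go zero    = inj₂ (inj₂ (inj₁ j)) , zero , cong (λ x → zero , R x) (Finₚ.toℕ-fromℕ< x<ℓ)
      go (suc r) = inj₂ (inj₂ (inj₁ (opposite j))) , suc r ,
        cong (λ x → suc r , R x) (trans (cong toℕ (Finₚ.opposite-involutive j)) (Finₚ.toℕ-fromℕ< x<ℓ))
  ... | right _ x<′ with cut h₁ x<′
  ...   | left e = inj₁ (r , inj₁ (opposite e)) , zero , cong (r ,_) (left-centre e)
  ...   | right _ x<″ with cut m x<″
  ...     | left s = slot (cut m′ (subst (toℕ s <_) (+-comm 1 m′) (Finₚ.toℕ<n s)))
    where
    received : ∀ (s : Fin m′) → ∃ λ t → ∃ λ i → star t i ≡ (r , T (toℕ s))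
    received s with Finₚ.combine-surjective {m} {2} r
    ... | i′ , X′ , refl =
      let i = punchIn i′ s
          i≢i′ = Finₚ.punchInᵢ≢i i′ s
          (j , p) = sends i i′ i≢i′ (side i i′ X′)
      in inj₂ (inj₁ (row i (side i i′ X′))) , suc j , trans p
           (cong₂ (λ X s → row i′ X , T (toℕ s)) (side-involutive i i′ X′)
             (Finₚ.punchOut-punchIn i′))
    last : ∀ r → ∃ λ t → ∃ λ i → star t i ≡ (r , T m′)
    last zero    = inj₂ (inj₂ (inj₂ zero)) , zero , refl
    last (suc r) = inj₂ (inj₂ (inj₂ zero)) , suc r , refl
    slot : ∀ {x} → Cut m′ 1 x → ∃ λ t → ∃ λ i → star t i ≡ (r , T x)
    slot (left s)                = received s
    slot (right zero _)          = subst (λ x → ∃ λ t → ∃ λ i → star t i ≡ (r , T x)) (sym (+-identityʳ m′)) (last r)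
    slot (right (suc _) (s≤s ()))
  ...     | right _ x<‴ with cut (n * h) x<‴
  ...       | left x = let (s , j , p) = leaves-covered (Finₚ.toℕ<n x) in inj₁ (r , s) , suc j , cong (r ,_) p
  ...       | right x x<m = let (i , p) = mixed-hit r (inj₁ (fromℕ< x<m)) in
                inj₂ (inj₁ r) , suc i , trans p (cong (λ x → r , nearLeaf x) (Finₚ.toℕ-fromℕ< x<m))

  -- Besides cross and fixed stars, two rows share one difference, plus or minus `T s`, coming from
  -- a mixed star or from the matching.
  data Link (r r′ : Fin (suc n)) : Set where
    forth : ∀ s → s < m → (∀ {y y′} → 0 + y′ ≈ T s + y → Adjacent r y r′ y′) → Link r r′
    back  : ∀ s → s < m → (∀ {y y′} → T s + y′ ≈ 0 + y → Adjacent r y r′ y′) → Link r r′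

  link-sym : ∀ {r r′} → Link r r′ → Link r′ r
  link-sym (forth s s<m adj) = back s s<m (λ e → joined-sym base match (adj (≈-sym e)))
  link-sym (back s s<m adj)  = forth s s<m (λ e → joined-sym base match (adj (≈-sym e)))

  link-arc : ∀ {i i′} (i≢i′ : i ≢ i′) X → Link (row i X) (row i′ (side i i′ X))
  link-arc {i} {i′} i≢i′ X =
    let (j , p) = sends i i′ i≢i′ X
        s = punchOut (i≢i′ ∘ sym)
    in forth (toℕ s) (m<n⇒m<1+n (Finₚ.toℕ<n s)) (star-arc (inj₂ (inj₁ (row i X))) j refl p)

  link-pair : ∀ i → Link (row i zero) (row i (suc zero))
  link-pair i = forth 0 (s≤s z≤n) joined
    where
    joined : ∀ {y y′} → 0 + y′ ≈ T 0 + y → Adjacent (row i zero) y (row i (suc zero)) y′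
    joined {y} {y′} eq with hit pairList (i , cls y)
    ... | c , e = matched c zero (cong (λ p → pairEnd p zero) e) (cong (λ p → pairEnd p (suc zero)) e)
      (toℕ-cls≈ y) (≈-trans (+-congʳ-≈ (T 0) (toℕ-cls≈ y)) (≈-trans (≈-reflexive (+-comm y (T 0))) (≈-sym eq)))

  -- For i < i′ the arc leaves `i` if the second coordinates agree, and leaves `i′` otherwise.
  link-< : ∀ {i i′} → i Fin.< i′ → ∀ X X′ → Link (row i X) (row i′ X′)
  link-< {i} {i′} i<i′ X X′ with X Finₚ.≟ X′
  ... | yes refl = subst (λ X′ → Link (row i X) (row i′ X′)) (side-< i<i′ X) (link-arc (Finₚ.<⇒≢ i<i′) X)
  ... | no X≢X′ = link-sym (subst (λ X → Link (row i′ X′) (row i X))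
      (trans (side-> i<i′ X′) (≢⇒flip₂ (X≢X′ ∘ sym))) (link-arc (Finₚ.<⇒≢ i<i′ ∘ sym) X′))

  link : ∀ r r′ → r ≢ r′ → Link r r′
  link r r′ r≢r′ with Finₚ.combine-surjective {m} {2} r | Finₚ.combine-surjective {m} {2} r′
  ... | i , X , refl | i′ , X′ , refl with Finₚ.<-cmp i i′
  ...   | tri< i<i′ _ _ = link-< i<i′ X X′
  ...   | tri> _ _ i>i′ = link-sym (link-< i>i′ X′ X)
  ...   | tri≈ _ refl _ = partners X X′ r≢r′
    where
    partners : ∀ X X′ → row i X ≢ row i X′ → Link (row i X) (row i X′)
    partners zero       zero       r≢r′ = ⊥-elim (r≢r′ refl)
    partners zero       (suc zero) r≢r′ = link-pair i
    partners (suc zero) zero       r≢r′ = link-sym (link-pair i)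
    partners (suc zero) (suc zero) r≢r′ = ⊥-elim (r≢r′ refl)

  source target : ∀ {r r′} → Link r r′ → ℕ
  source (forth s _ _) = 0
  source (back s _ _)  = T s
  target (forth s _ _) = T s
  target (back s _ _)  = 0

  link-joined : ∀ {r r′} (l : Link r r′) {y y′} → source l + y′ ≈ target l + y → Adjacent r y r′ y′
  link-joined (forth _ _ adj) = adj
  link-joined (back _ _ adj)  = adj

  ℓ≤maxJump : ℓ ≤ maxJump
  ℓ≤maxJump = ≤-trans (m≤n+m ℓ h) (≤-trans (≤-reflexive (cong (h +_) (*-comm h (m′ * 2)))) (m≤m+n (n * h) m))

  T≡ : ∀ s → T s ≡ suc (n * h + s)
  T≡ s = trans (sym (+-assoc (suc E₀) h₁ s)) (cong (_+ s) T-start)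

  T+i<a : ∀ {s i} → s < m → i < ℓ → T s + i < suc k
  T+i<a {s} {i} s<m i<ℓ = begin-strict
    T s + i                       ≡⟨ cong (_+ i) (T≡ s) ⟩
    suc (n * h + s) + i           <⟨ +-mono-< (s<s (+-monoʳ-< (n * h) s<m)) (<-≤-trans i<ℓ ℓ≤maxJump) ⟩
    1 + (maxJump + maxJump)       ≡⟨ halves ⟩
    suc k                         ∎
    where open ≤-Reasoning

  T<a : ∀ {s} → s < m → T s < suc k
  T<a {s} s<m = begin-strict
    T s                      ≡⟨ T≡ s ⟩
    suc (n * h + s)          <⟨ s<s (+-monoʳ-< (n * h) s<m) ⟩
    1 + maxJump              ≤⟨ s≤s (m≤m+n maxJump maxJump) ⟩
    1 + (maxJump + maxJump)  ≡⟨ halves ⟩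
    suc k                    ∎
    where open ≤-Reasoning

  T≉0 : ∀ {s} → s < m → ¬ T s ≈ 0
  T≉0 s<m e = case small (T<a s<m) (s≤s z≤n) e of λ ()

  i<ℓ⇒i<a : ∀ {i} → i < ℓ → i < suc k
  i<ℓ⇒i<a i<ℓ = ≤-<-trans (m≤n+m _ (T 0)) (T+i<a (s≤s z≤n) i<ℓ)

  -- After cancelling `suc h₂` both sides are reduced residues, but the left one is at least ℓ.
  T+R≉R : ∀ {s} → s < m → (i j : Fin ℓ) → ¬ T s + R (toℕ i) ≈ R (toℕ j)
  T+R≉R {s} s<m i j e = <⇒≱ (Finₚ.toℕ<n j) (begin
    ℓ                       ≤⟨ ≤-trans (m≤n+m ℓ (suc h₂)) (m≤m+n (suc E₀) (h₁ + s)) ⟩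
    T s                     ≤⟨ m≤m+n (T s) (toℕ i) ⟩
    T s + toℕ i             ≡⟨ small (T+i<a s<m (Finₚ.toℕ<n i)) (i<ℓ⇒i<a (Finₚ.toℕ<n j)) cancelled ⟩
    toℕ j                   ∎)
    where
    open ≤-Reasoning
    lemma : ∀ t h₂ i → t + i + suc h₂ ≡ t + suc (h₂ + i)
    lemma = solve-∀
    cancelled : T s + toℕ i ≈ toℕ j
    cancelled = +-cancelʳ-≈ (suc h₂) (≈-trans (≈-reflexive (lemma (T s) h₂ (toℕ i)))
      (≈-trans e (≈-reflexive (+-comm (suc h₂) (toℕ j)))))

  link≉cross : ∀ {r r′} (l : Link r r′) c → ¬ target l + from c ≈ to c + source l
  link≉cross (forth s s<m _) (inj₁ j) e = T+R≉R s<m j (opposite j) (≈-trans e (≈-reflexive (+-identityʳ _)))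
  link≉cross (back s s<m _)  (inj₁ j) e =
    T+R≉R s<m (opposite j) j (≈-trans (≈-reflexive (+-comm (T s) (R (toℕ (opposite j))))) (≈-sym e))
  link≉cross (forth s s<m _) (inj₂ _) e =
    T≉0 s<m (+-cancelʳ-≈ (T m′) (≈-trans e (≈-reflexive (+-identityʳ (T m′)))))
  link≉cross (back s s<m _)  (inj₂ _) e =
    T≉0 s<m (+-cancelʳ-≈ (T m′) (≈-trans (≈-reflexive (+-comm (T s) (T m′))) (≈-sym e)))

  -- ℓ is even, so no j is its own opposite.
  R≉R-opposite : ∀ (j : Fin ℓ) → ¬ R (toℕ (opposite j)) ≈ R (toℕ j)
  R≉R-opposite j e = even≢odd (h * m′) (toℕ j) (begin
    2 * (h * m′)                     ≡⟨ lemma h m′ ⟩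
    ℓ                                ≡⟨ opposite-sum j ⟨
    toℕ j + suc (toℕ (opposite j))   ≡⟨ cong (λ x → toℕ j + suc x) opposite≡ ⟩
    toℕ j + suc (toℕ j)              ≡⟨ +-suc (toℕ j) (toℕ j) ⟩
    suc (toℕ j + toℕ j)              ≡⟨ cong (λ x → suc (toℕ j + x)) (+-identityʳ (toℕ j)) ⟨
    suc (2 * toℕ j)                  ∎)
    where
    open ≡-Reasoning
    lemma : ∀ h m′ → 2 * (h * m′) ≡ h * (m′ * 2)
    lemma = solve-∀
    opposite≡ : toℕ (opposite j) ≡ toℕ j
    opposite≡ = small (i<ℓ⇒i<a (Finₚ.toℕ<n (opposite j))) (i<ℓ⇒i<a (Finₚ.toℕ<n j)) (+-cancelʳ-≈ (suc h₂)
      (≈-trans (≈-reflexive (+-comm (toℕ (opposite j)) _)) (≈-trans e (≈-reflexive (+-comm (suc h₂) _)))))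

  crossings-distinct : ∀ c c′ → to c + from c′ ≈ to c′ + from c → c ≡ c′
  crossings-distinct (inj₁ i) (inj₁ j) e = cong inj₁ (opposite-crossing-≈ k (suc h₂)
    (≤-trans (+-mono-≤ ℓ≤maxJump ℓ≤maxJump) (≤-trans (n≤1+n _) (≤-reflexive halves))) i j e)
  crossings-distinct (inj₁ i) (inj₂ zero) e = ⊥-elim (R≉R-opposite i
    (+-cancelʳ-≈ (T m′) (≈-trans e (≈-reflexive (+-comm (T m′) (R (toℕ i)))))))
  crossings-distinct (inj₂ zero) (inj₁ i) e = ⊥-elim (R≉R-opposite i
    (+-cancelʳ-≈ (T m′) (≈-trans (≈-sym e) (≈-reflexive (+-comm (T m′) (R (toℕ i)))))))
  crossings-distinct (inj₂ zero) (inj₂ zero) e = refl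

  -- Rows other than row 0 share only their link outside the fixed stars, hence `maxJump` for each;
  -- against row 0 the link and the ℓ + 1 cross stars leave `h + m′`.
  rowCount : Fin (suc n) → ℕ
  rowCount = firstRow (h + m′) maxJump

  design : Design base match (h + m′ + n * maxJump)
  design = record
    { f = rowCount
    ; f-listing = firstRow-listing (h + m′) maxJump
    ; baseCovers = λ _ r x x<a → let (s , i , p) = covers r x x<a ; (b , q) = hit stars s in
        b , i , trans (cong (λ s → star s i) q) p
    ; matchCovers = matchCovers
    ; rows = rows
    ; pairs = pairs }
    where
    matchCovers : ∀ r x → x < suc k → ∃ λ c → ∃ λ b → ∃ λ x′ → match c b ≡ (r , x′) × x′ ≈ x
    matchCovers r x x<a with Finₚ.combine-surjective {m} {2} r
    ... | i , zero , refl =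
      let (c , p) = hit pairList (i , fromℕ< x<a) in
      c , zero , x , trans (cong (λ p → pairEnd p zero) p) (cong (row i zero ,_) (Finₚ.toℕ-fromℕ< x<a)) , ≈-refl
    ... | i , suc zero , refl =
      let (c , p) = hit pairList (i , cls (x + T 0 * k)) in
      c , suc zero , _ , cong (λ p → pairEnd p (suc zero)) p ,
        ≈-trans (+-congʳ-≈ (T 0) (toℕ-cls≈ (x + T 0 * k))) (neg-+-cancel x (T 0))

    near-jump : ∀ x x′ → x + suc x′ ≡ m → nearLeaf x + suc x′ ≈ 0
    near-jump x x′ e = wraps 0 1 (trans (lemma (suc E₀) h₁ m (n * h) x (suc x′))
      (cong (λ z → suc E₀ + (h₁ + (m + (n * h + z))) + 0) e))
      where
      lemma : ∀ e h₁ m p x y → e + (h₁ + (m + (p + x))) + y + 0 ≡ e + (h₁ + (m + (p + (x + y)))) + 0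
      lemma = solve-∀

    opposite-sum′ : ∀ (x : Fin m) → toℕ (opposite x) + suc (toℕ x) ≡ m
    opposite-sum′ x = trans (cong (λ x′ → toℕ (opposite x) + suc (toℕ x′)) (sym (Finₚ.opposite-involutive x)))
                            (opposite-sum (opposite x))

    jump : ∀ r {x} → x < maxJump → ∀ {y y′} → y + suc x ≈ y′ → Adjacent r y r y′
    jump r {x} x<J = go (cut m (subst (x <_) (+-comm (n * h) m) x<J))
      where
      go : ∀ {x} → Cut m (n * h) x → ∀ {y y′} → y + suc x ≈ y′ → Adjacent r y r y′
      -- Jumps 1 to m run from the near leaves of the mixed star to its centre at 0; the longer ones
      -- come from the zigzag.
      go (left x) p =
        let (i , e) = mixed-hit r (inj₁ (opposite x)) in
        joined-sym base match (star-arc (inj₂ (inj₁ r)) i refl e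
          (≈-sym (parallel k (near-jump (toℕ (opposite x)) (toℕ x) (opposite-sum′ x)) p)))
      go (right x x<nh) p with jumps parity x<nh
      ... | s , j , inj₁ e = star-arc (inj₁ (r , s)) j refl refl (parallel k e p)
      ... | s , j , inj₂ e =
        joined-sym base match (star-arc (inj₁ (r , s)) j refl refl (≈-sym (parallel k e p)))

    rows : ∀ r {y y′} → y < y′ → y′ < suc k → Adjacent r y r y′
    rows r {y} {y′} y<y′ y′<a with m≤n⇒∃[o]m+o≡n y<y′
    -- The row length is 1 + 2 `maxJump`, so a distance or its complement is at most `maxJump`.
    ... | d , refl with d <? maxJump
    ...   | yes d<J = jump r d<J (≈-reflexive (+-suc y d))
    ...   | no d≮J with m≤n⇒∃[o]m+o≡n y′<a | m≤n⇒∃[o]m+o≡n (≮⇒≥ d≮J)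
    ...     | p , y′+p | o , refl = joined-sym base match (jump r p+y<J (wraps 0 1 (around y d p _ y′+p)))
      where
      p+y<J : p + y < maxJump
      p+y<J = +⇒≤ o (+-cancelʳ-≡ maxJump (suc (p + y) + o) maxJump
        (suc-injective (trans (lemma p y o maxJump) (trans y′+p (sym halves)))))
        where
        lemma : ∀ p y o J → 1 + (suc (p + y) + o + J) ≡ suc (suc y + (J + o)) + p
        lemma = solve-∀

    pairs : ∀ {r r′} → r Fin.< r′ → Differences base match rowCount r r′
    pairs {zero} {suc r} r<r′ = record
      { β = suc (ℓ + 1)
      ; src = λ { zero → source l ; (suc i) → from (splitAt ℓ i) }
      ; tgt = λ { zero → target l ; (suc i) → to (splitAt ℓ i) }
      ; distinct = λ
          { {zero}  {zero}  e → refl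
          ; {zero}  {suc j} e → ⊥-elim (link≉cross l (splitAt ℓ j) e)
          ; {suc i} {zero}  e → ⊥-elim (link≉cross l (splitAt ℓ i) (≈-sym e))
          ; {suc i} {suc j} e →
              cong suc (splitAt-injective ℓ (crossings-distinct (splitAt ℓ i) (splitAt ℓ j) e)) }
      ; total = OddCounts.classes m′ h₁ h₂
      ; joined = λ
          { zero → link-joined l
          ; (suc i) → star-arc (inj₂ (inj₂ (splitAt ℓ i))) r refl refl } }
      where
      l : Link zero (suc r)
      l = link zero (suc r) (Finₚ.<⇒≢ r<r′)
    pairs {suc r} {suc r′} r<r′ = record
      { β = 1
      ; src = λ _ → source l
      ; tgt = λ _ → target l
      ; distinct = λ { {zero} {zero} _ → refl }
      ; total = halves
      ; joined = λ _ → link-joined l }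
      where
      l : Link (suc r) (suc r′)
      l = link (suc r) (suc r′) (Finₚ.<⇒≢ r<r′)

  urd : URD (K 2) (Star n) (suc n * suc k) 1 (1 * suc k + (h + m′ + n * maxJump))
  urd = FromDesign.designURD base match design (matchings m (suc k)) (OddCounts.total m′ h₁ h₂)
    where
    matchings : ∀ m a → m * a * 2 ≡ m * 2 * a
    matchings = solve-∀

-- The case q = 0, and all admissible orders

module SmallestDesign (n : ℕ) where

  open Residues 1

  base : Fin 0 → Fin 2 → Fin (suc n) → Row×ℕ n
  base ()

  match : Fin (suc n) → Fin 2 → Row×ℕ n
  match r b = r , toℕ b

  -- Each row has two points, joined by the matching. Two rows have two differences, one for the
  -- fixed class of either row.
  design : Design base match (suc n * 1)
  design = record
    { f = λ _ → 1
    ; f-listing = Fin-listing (suc n) ×-listing Fin-listing 1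
    ; baseCovers = λ ()
    ; matchCovers = λ r x x<2 → r , fromℕ< x<2 , x , cong (r ,_) (Finₚ.toℕ-fromℕ< x<2) , ≈-refl
    ; rows = rows
    ; pairs = λ _ → record
        { β = 0 ; src = λ () ; tgt = λ () ; distinct = λ { {()} } ; total = refl ; joined = λ () } }
    where
    rows : ∀ r {y y′} → y < y′ → y′ < 2 → Joined base match r y r y′
    rows r {zero}  {suc zero}    _ _ = matched r zero refl refl ≈-refl ≈-refl
    rows r {suc y} {suc zero}    (s≤s ()) _
    rows r {y}     {suc (suc _)} _ (s≤s (s≤s ()))

  urd : URD (K 2) (Star n) (suc n * 2) 1 (0 * 2 + suc n * 1)
  urd = FromDesign.designURD base match design refl (count n)
    where
    count : ∀ n → suc n * (suc n * 2) ≡ 2 * suc n + (0 * 2 + suc n * 1) * (n * 2)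
    count = solve-∀

module Sufficiency (m′ : ℕ) where

  n : ℕ
  n = suc (m′ * 2)

  Exists : ℕ → Set
  Exists v = ∃ λ s → 0 < s × URD (K 2) (Star n) v 1 s

  even-exists : ∀ h → Exists (suc n * (2 + 2 * h * n))
  even-exists zero    = _ , s≤s z≤n , SmallestDesign.urd n
  even-exists (suc h) = subst Exists (cong (suc n *_) columns) (_ , s≤s z≤n , EvenDesign.urd m′ ⌊ h /2⌋ ⌈ h /2⌉ classify)
    where
    h≡ = ⌊n/2⌋+⌈n/2⌉≡n h
    -- Among the h + 1 indices, ⌊h/2⌋ + 1 are even and ⌈h/2⌉ are odd.
    classify : ∀ i → i < suc ⌊ h /2⌋ + ⌈ h /2⌉ → EvenOdd (suc ⌊ h /2⌋) ⌈ h /2⌉ i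
    classify i i<h = evenOdd (suc h) i (subst (λ z → i < suc z) h≡ i<h)
    lemma : ∀ p h → suc (p * suc h) + suc (p * suc h) ≡ 2 + 2 * suc h * p
    lemma = solve-∀
    columns : suc (EvenDesign.k m′ ⌊ h /2⌋ ⌈ h /2⌉ classify) ≡ 2 + 2 * suc h * n
    columns = trans (sym (EvenDesign.halves m′ ⌊ h /2⌋ ⌈ h /2⌉ classify))
      (trans (cong (λ h → suc (n * suc h) + suc (n * suc h)) h≡) (lemma n h))

  odd-exists : ∀ h → Exists (suc n * (2 + suc (2 * h) * n))
  odd-exists h = subst Exists (cong (suc n *_) columns) (_ , s≤s z≤n , OddDesign.urd m′ ⌈ h /2⌉ ⌊ h /2⌋ classify)
    where
    h≡ : ⌈ h /2⌉ + ⌊ h /2⌋ ≡ h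
    h≡ = trans (+-comm ⌈ h /2⌉ ⌊ h /2⌋) (⌊n/2⌋+⌈n/2⌉≡n h)
    classify : ∀ i → i < ⌈ h /2⌉ + ⌊ h /2⌋ → EvenOdd ⌈ h /2⌉ ⌊ h /2⌋ i
    classify i i<h = evenOdd h i (subst (i <_) h≡ i<h)
    lemma : ∀ m′ h → let n = suc (m′ * 2) in
      1 + (n * h + (1 + m′) + (n * h + (1 + m′))) ≡ 2 + suc (2 * h) * n
    lemma = solve-∀
    columns : suc (OddDesign.k m′ ⌈ h /2⌉ ⌊ h /2⌋ classify) ≡ 2 + suc (2 * h) * n
    columns = trans (sym (OddDesign.halves m′ ⌈ h /2⌉ ⌊ h /2⌋ classify))
      (trans (cong (λ h → 1 + (n * h + suc m′ + (n * h + suc m′))) h≡) (lemma m′ h))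

  exists : ∀ q → Exists (suc n * (2 + q * n))
  exists q = go (evenOdd (suc q) q ≤-refl)
    where
    go : ∀ {h₁ h₂ q} → EvenOdd h₁ h₂ q → Exists (suc n * (2 + q * n))
    go (even i) = even-exists (toℕ i)
    go (odd i)  = odd-exists (toℕ i)

-- Necessity: counting ordered pairs of vertices

bijection : ∀ {A B : Set} (f : A → B) → Injective _≡_ _≡_ f → (∀ y → ∃ λ x → f x ≡ y) → A ↔ B
bijection f inj sur = ⤖⇒↔ (mk⤖ (inj , λ y → let (x , p) = sur y in x , λ { refl → p }))

class-order : ∀ {H v} (C : ParallelClass H (K v)) → size C * order H ≡ v
class-order {H} {v} C = ↔⇒≡ (bijection vertex vertex-injective vertex-onto ↔-∘ Finₚ.*↔×)
  where
  vertex : Fin (size C) × Vertex H → Fin v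
  vertex (i , a) = embed (block C i) a
  vertex-onto : ∀ x → ∃ λ p → vertex p ≡ x
  vertex-onto x = let (i , (a , p) , _) = spanning C x in (i , a) , p
  vertex-injective : Injective _≡_ _≡_ vertex
  vertex-injective {i , a} {j , b} e with spanning C (vertex (j , b))
  ... | _ , _ , unique with unique {i} (a , e) | unique {j} (b , refl)
  ...   | refl | refl = cong (i ,_) (injective (block C i) e)

dart-injective : ∀ {n} (d d′ : Dart n) → tail d ≡ tail d′ → head d ≡ head d′ → d ≡ d′
dart-injective (i , zero)     (j , zero)     _ e = cong (_, zero) (Finₚ.suc-injective e)
dart-injective (i , zero)     (j , suc zero) () _
dart-injective (i , suc zero) (j , zero)     () _
dart-injective (i , suc zero) (j , suc zero) e _ = cong (_, suc zero) (Finₚ.suc-injective e)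

module Necessity {n v s : ℕ} (U : URD (K 2) (Star n) v 1 s) where

  open URD U

  w : ℕ
  w = size (class₁ zero)

  StarIndex : Set
  StarIndex = Σ (Fin s) (λ c → Fin (size (class₂ c)))

  Darts : Set
  Darts = Fin v ⊎ (Fin w × Fin 2) ⊎ (StarIndex × Dart n)

  ends : Darts → Fin v × Fin v
  ends (inj₁ x) = x , x
  ends (inj₂ (inj₁ (i , b))) = embed (block (class₁ zero) i) b , embed (block (class₁ zero) i) (flip₂ b)
  ends (inj₂ (inj₂ ((c , i) , d))) = embed (block (class₂ c) i) (tail d) , embed (block (class₂ c) i) (head d)

  ends-onto : ∀ p → ∃ λ d → ends d ≡ p
  ends-onto (x , y) with x Finₚ.≟ y
  ... | yes refl = inj₁ x , refl
  ... | no x≢y with decomposes x≢y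
  ...   | inj₁ (zero , i) , (b , b′ , b≢b′ , p , q) , _ = inj₂ (inj₁ (i , b)) ,
            cong₂ _,_ p (trans (cong (embed (block (class₁ zero) i)) (≢⇒flip₂ b≢b′)) q)
  ...   | inj₂ (c , i) , (b , b′ , adj , p , q) , _ =
            let (d , t , h) = star-dart adj in inj₂ (inj₂ ((c , i) , d)) ,
            cong₂ _,_ (trans (cong (embed (block (class₂ c) i)) t) p) (trans (cong (embed (block (class₂ c) i)) h) q)

  same-block : ∀ {x y} β β′ → x ≢ y → EdgeOfBlock x y β → EdgeOfBlock x y β′ → β ≡ β′
  same-block _ _ x≢y e e′ = let (_ , _ , unique) = decomposes x≢y in trans (sym (unique e)) (unique e′)

  matching-edge : ∀ i b → let (x , y) = ends (inj₂ (inj₁ (i , b))) in x ≢ y × EdgeOfBlock x y (inj₁ (zero , i))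
  matching-edge i b = preserves (block (class₁ zero) i) (≢-flip₂ b) , b , flip₂ b , ≢-flip₂ b , refl , refl

  star-edge : ∀ ci d → let (x , y) = ends (inj₂ (inj₂ (ci , d))) in x ≢ y × EdgeOfBlock x y (inj₂ ci)
  star-edge (c , i) d =
    preserves (block (class₂ c) i) {tail d} {head d} (star-adjacent d) , tail d , head d , star-adjacent d , refl , refl

  transport : ∀ {p q : Fin v × Fin v} β → p ≡ q → EdgeOfBlock (proj₁ p) (proj₂ p) β → EdgeOfBlock (proj₁ q) (proj₂ q) β
  transport _ refl e = e

  loop≢ : ∀ {x} {p : Fin v × Fin v} → (x , x) ≡ p → ¬ proj₁ p ≢ proj₂ p
  loop≢ refl x≢x = x≢x refl

  -- Off-diagonal darts with the same ends lie in one block by the uniqueness in `decomposes`, and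
  -- within a block the embedding separates them.
  ends-injective : Injective _≡_ _≡_ ends
  ends-injective {inj₁ x} {inj₁ y} e = cong (inj₁ ∘ proj₁) e
  ends-injective {inj₁ x} {inj₂ (inj₁ (i , b))} e = ⊥-elim (loop≢ e (proj₁ (matching-edge i b)))
  ends-injective {inj₁ x} {inj₂ (inj₂ (ci , d))} e = ⊥-elim (loop≢ e (proj₁ (star-edge ci d)))
  ends-injective {inj₂ (inj₁ (i , b))} {inj₁ y} e = ⊥-elim (loop≢ (sym e) (proj₁ (matching-edge i b)))
  ends-injective {inj₂ (inj₂ (ci , d))} {inj₁ y} e = ⊥-elim (loop≢ (sym e) (proj₁ (star-edge ci d)))
  ends-injective {inj₂ (inj₁ (i , b))} {inj₂ (inj₁ (i′ , b′))} e
    with same-block (inj₁ (zero , i)) (inj₁ (zero , i′)) (proj₁ (matching-edge i′ b′))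
           (transport (inj₁ (zero , i)) e (proj₂ (matching-edge i b))) (proj₂ (matching-edge i′ b′))
  ... | refl = cong (λ b → inj₂ (inj₁ (i , b))) (injective (block (class₁ zero) i) (cong proj₁ e))
  ends-injective {inj₂ (inj₁ (i , b))} {inj₂ (inj₂ (ci , d))} e
    with same-block (inj₁ (zero , i)) (inj₂ ci) (proj₁ (star-edge ci d))
           (transport (inj₁ (zero , i)) e (proj₂ (matching-edge i b))) (proj₂ (star-edge ci d))
  ... | ()
  ends-injective {inj₂ (inj₂ (ci , d))} {inj₂ (inj₁ (i , b))} e
    with same-block (inj₂ ci) (inj₁ (zero , i)) (proj₁ (star-edge ci d))
           (proj₂ (star-edge ci d)) (transport (inj₁ (zero , i)) (sym e) (proj₂ (matching-edge i b)))
  ... | ()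
  ends-injective {inj₂ (inj₂ ((c , i) , d))} {inj₂ (inj₂ ((c′ , i′) , d′))} e
    with same-block (inj₂ (c , i)) (inj₂ (c′ , i′)) (proj₁ (star-edge (c′ , i′) d′))
           (transport (inj₂ (c , i)) e (proj₂ (star-edge (c , i) d))) (proj₂ (star-edge (c′ , i′) d′))
  ... | refl = cong (λ d → inj₂ (inj₂ ((c , i) , d)))
        (dart-injective d d′ (injective (block (class₂ c) i) (cong proj₁ e))
          (injective (block (class₂ c) i) (cong proj₂ e)))

  starIndex : ∀ a → a * suc n ≡ v → StarIndex ↔ Fin (s * a)
  starIndex a a*sn = ↔-sym Finₚ.*↔× ↔-∘ mk↔ₛ′
    (λ (c , i) → c , cast (size≡ c) i) (λ (c , i) → c , cast (sym (size≡ c)) i)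
    (λ (c , i) → cong (c ,_) (Finₚ.cast-involutive (size≡ c) (sym (size≡ c)) i))
    (λ (c , i) → cong (c ,_) (Finₚ.cast-involutive (sym (size≡ c)) (size≡ c) i))
    where
    size≡ : ∀ c → size (class₂ c) ≡ a
    size≡ c = *-cancelʳ-≡ (size (class₂ c)) a (suc n) (trans (class-order (class₂ c)) (sym a*sn))

  dart-count : ∀ a → a * suc n ≡ v → v + (v + (s * a) * (n * 2)) ≡ v * v
  dart-count a a*sn = trans (cong (λ z → v + (z + (s * a) * (n * 2))) (sym (class-order (class₁ zero))))
    (↔⇒≡ (↔-sym Finₚ.*↔× ↔-∘ (bijection ends ends-injective ends-onto ↔-∘ ↔-sym darts)))
    where
    darts : Darts ↔ Fin (v + (w * 2 + (s * a) * (n * 2)))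
    darts = ↔-sym Finₚ.+↔⊎ ↔-∘ (↔-id (Fin v) ⊎-↔ (↔-sym Finₚ.+↔⊎ ↔-∘
      (↔-sym Finₚ.*↔× ⊎-↔ (↔-sym Finₚ.*↔× ↔-∘ (starIndex a a*sn ×-↔ ↔-sym Finₚ.*↔×)))))

-- Arithmetic of the admissible orders

dart-count⇒congruent : ∀ n s a → 1 < n → 0 < a → let v = a * suc n in
  v + (v + (s * a) * (n * 2)) ≡ v * v → v ≡ 2 * (n + 1) [mod n * (n + 1) ]
dart-count⇒congruent n s a@(suc a′) 1<n 0<a count = go a′ (*-cancelˡ-≡ _ _ a (trans (trans (lemma n s a) count) (lemma′ n a)))
  where
  lemma : ∀ n s a → a * (2 * suc n + s * (n * 2)) ≡ a * suc n + (a * suc n + (s * a) * (n * 2))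
  lemma = solve-∀
  lemma′ : ∀ n a → a * suc n * (a * suc n) ≡ a * (suc n * (a * suc n))
  lemma′ = solve-∀
  go : ∀ a′ → 2 * suc n + s * (n * 2) ≡ suc n * (suc a′ * suc n) → suc a′ * suc n ≡ 2 * (n + 1) [mod n * (n + 1) ]
  -- If a = 1, the equation gives n ∣ 1.
  go zero eq = ⊥-elim (<⇒≱ 1<n (∣⇒≤ (∣m+n∣m⇒∣n n∣ (m∣m*n {n} (2 * s)))))
    where
    lemma″ : ∀ n s → n * (2 * s) + 1 + (1 + 2 * n) ≡ 2 * suc n + s * (n * 2)
    lemma″ = solve-∀
    lemma‴ : ∀ n → suc n * (1 * suc n) ≡ n * n + (1 + 2 * n)
    lemma‴ = solve-∀
    n∣ : n ∣ n * (2 * s) + 1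
    n∣ = subst (n ∣_) (sym (+-cancelʳ-≡ (1 + 2 * n) _ _ (trans (lemma″ n s) (trans eq (lemma‴ n))))) (m∣m*n {n} n)
  -- If a = d + 2, the equation gives n ∣ d.
  go (suc d) eq with ∣m+n∣m⇒∣n n∣ (m∣m*n {n} (2 * n + 4 + d * n + 2 * d))
    where
    lemma″ : ∀ n s → n * (2 * s + 2) + 2 ≡ 2 * suc n + s * (n * 2)
    lemma″ = solve-∀
    lemma‴ : ∀ n d → suc n * (suc (suc d) * suc n) ≡ n * (2 * n + 4 + d * n + 2 * d) + d + 2
    lemma‴ = solve-∀
    n∣ : n ∣ n * (2 * n + 4 + d * n + 2 * d) + d
    n∣ = subst (n ∣_) (+-cancelʳ-≡ 2 _ _ (trans (lemma″ n s) (trans eq (lemma‴ n d)))) (m∣m*n {n} (2 * s + 2))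
  ... | divides q refl = subst (n * (n + 1) ∣_) (sym difference) (n∣m*n q)
    where
    expand : ∀ n q → (2 + q * n) * suc n ≡ 2 * (n + 1) + q * (n * (n + 1))
    expand = solve-∀
    difference : ∣ (2 + q * n) * suc n - 2 * (n + 1) ∣ ≡ q * (n * (n + 1))
    difference = trans (cong ∣_- 2 * (n + 1) ∣ (expand n q))
      (trans (∣-∣-comm (2 * (n + 1) + q * (n * (n + 1))) (2 * (n + 1))) (∣m-m+n∣≡n (2 * (n + 1)) _))

-- The congruence is an absolute difference, so v < 2 (n + 1) has to be excluded: n (n + 1) would
-- divide the positive number 2 (n + 1) - v, which is less than 2 (n + 1) ≤ n (n + 1).
congruent⇒order : ∀ n v → 1 < n → 0 < v → v ≡ 2 * (n + 1) [mod n * (n + 1) ] → ∃ λ q → suc n * (2 + q * n) ≡ v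
congruent⇒order n v 1<n 0<v div with 2 * (n + 1) ≤? v
... | yes u≤v with subst (n * (n + 1) ∣_) (trans (∣-∣-comm v (2 * (n + 1))) (m≤n⇒∣m-n∣≡n∸m u≤v)) div
...   | divides q eq = q , trans (expand n q) (trans (cong (2 * (n + 1) +_) (sym eq)) (m+[n∸m]≡n u≤v))
  where
  expand : ∀ n q → suc n * (2 + q * n) ≡ 2 * (n + 1) + q * (n * (n + 1))
  expand = solve-∀
congruent⇒order n v@(suc _) 1<n 0<v div | no u≰v = ⊥-elim (<⇒≱ u∸v<u (≤-trans (*-monoˡ-≤ (n + 1) 1<n) (∣⇒≤ div′)))
  where
  u = 2 * (n + 1)
  v<u : v < u
  v<u = ≰⇒> u≰v
  instance
    positive : NonZero (u ∸ v)
    positive = >-nonZero (m<n⇒0<n∸m v<u)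
  div′ : n * (n + 1) ∣ u ∸ v
  div′ = subst (n * (n + 1) ∣_) (m≤n⇒∣m-n∣≡n∸m (<⇒≤ v<u)) div
  u∸v<u : u ∸ v < u
  u∸v<u = ∸-monoʳ-< {u} {v} {0} (s≤s z≤n) (<⇒≤ v<u)

odd⇒form : ∀ n → n % 2 ≡ 1 → suc ((n / 2) * 2) ≡ n
odd⇒form n n%2 = sym (trans (m≡m%n+[m/n]*n n 2) (cong (_+ (n / 2) * 2) n%2))

-- As `s` is positive there is a first star class; its size is the common number `a` of stars.
necessary : ∀ {n v s} → 1 < n → 0 < v → 0 < s → URD (K 2) (Star n) v 1 s → v ≡ 2 * (n + 1) [mod n * (n + 1) ]
necessary {n} {v} {suc s} 1<n 0<v 0<s U =
  subst (_≡ 2 * (n + 1) [mod n * (n + 1) ]) a*sn (dart-count⇒congruent n (suc s) a 1<n 0<a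
    (subst (λ v → v + (v + (suc s * a) * (n * 2)) ≡ v * v) (sym a*sn) (dart-count a a*sn)))
  where
  open Necessity U
  a = size (URD.class₂ U zero)
  a*sn : a * suc n ≡ v
  a*sn = class-order (URD.class₂ U zero)
  0<a : 0 < a
  0<a = n≢0⇒n>0 λ a≡0 → <⇒≢ 0<v (trans (cong (_* suc n) (sym a≡0)) a*sn)

mainTheorem1 : ∀ (n : ℕ) → 1 < n → n % 2 ≡ 1 →
    ∀ (v : ℕ) → 0 < v →
    (∃[ s ] (0 < s × URD (K 2) (Star n) v 1 s)) ⇔ (v ≡ 2 * (n + 1) [mod n * (n + 1) ])
mainTheorem1 n 1<n n%2 v 0<v = mk⇔ (λ (s , 0<s , U) → necessary 1<n 0<v 0<s U) sufficient
  where
  sufficient : v ≡ 2 * (n + 1) [mod n * (n + 1) ] → ∃[ s ] (0 < s × URD (K 2) (Star n) v 1 s)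
  sufficient c =
    let (q , order≡) = congruent⇒order n v 1<n 0<v c in
    subst (λ v → ∃[ s ] (0 < s × URD (K 2) (Star n) v 1 s)) order≡
      (subst (λ n → ∃[ s ] (0 < s × URD (K 2) (Star n) (suc n * (2 + q * n)) 1 s)) (odd⇒form n n%2)
        (Sufficiency.exists (n / 2) q))
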